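{- Let $\varphi\equiv\bigwedge_{i=1}^t\varphi_i$ be an $X$-positive basic conjunction of spread $m$ and range $r$ over a graph language $L\cup\{X\}$, and let $C,M\notin L\cup\{X\}$ be distinct unary predicate symbols. For $i=1,\ldots,t$ let $m_i$ be the spread of $\varphi_i$. Let $\varepsilon_1,\varepsilon_2>0$ be reals. Let $G$ be an $L$-interpretation and $\lambda$ a layering of $\overline{G}$. For an interval $I$ of consecutive integers let $G_I$ denote the $(L\cup\{C,M\})$-interpretation $G[\lambda^{ -1}(I)],C:=\lambda^{ -1}(M_{2r}(I)),M:=\lambda^{ -1}(M_r(I))$, and for a $t$-tuple $q$ of non-negative integers (with $q_i\le m_i$) let $A_{I,q}$ be a set with $G_I,X:=A_{I,q}\models\varphi^{(q)}$ and $|A_{I,q}|\le(1+\varepsilon_1)\gamma_{\varphi^{(q)}}(G_I)$, where $A_{I,q}$ is undefined if $G_I,X:=V(\overline{G_I})\not\models\varphi^{(q)}$. Let $\ell>2r(1+\max(2/\varepsilon_2,6mt))$ be an integer. For any $(\ell,r)$-cover $R$ of integers and any $t$-tuple $p=(p_1,\ldots,p_t)$ where each $p_i$ is an $m_i$-plan for $R$, let $p(I)=(p_1(I),\ldots,p_t(I))$, let $A_{R,p}=\bigcup_{I\in R}A_{I,p(I)}$ (undefined if any $A_{I,p(I)}$ is undefined), and let $a_{R,p}=\sum_{I\in R}|A_{I,p(I)}|$. Let $A$ be a set $A_{R,p}$ with $a_{R,p}$ minimum over all choices of $R$ and $p$ for which $A_{R,p}$ is defined ($A$ is undefined if no such $A_{R,p}$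 exists). Then either $G,X:=V(\overline{G})\not\models\varphi$ and $A$ is undefined, or $G,X:=A\models\varphi$ and $|A|\le(1+\varepsilon_1)(1+\varepsilon_2)\gamma_\varphi(G)$.
   Context: A graph language consists of a binary symbol $e$ (adjacency) and finitely many unary predicate symbols; an $L$-interpretation $G$ is a graph $\overline{G}$ together with a subset of $V(\overline{G})$ for each unary symbol of $L$. For $S\subseteq V(\overline{G})$, $G[S]$ is the interpretation on $\overline{G}[S]$ with unary predicates restricted to $S$; $H,X:=A$ means $H$ extended by interpreting $X$ as $A$. A formula is $X$-positive if every occurrence of $X$ lies within the scope of an even number of negations. For an $X$-positive sentence $\theta$ and interpretation $H$, $\gamma_\theta(H)$ is the minimum size of $A\subseteq V(\overline{H})$ with $H,X:=A\models\theta$. A layering of a graph $H$ is $\lambda:V(H)\to\mathbb{Z}$ with $|\lambda(u)-\lambda(v)|\le1$ for every edge $uv$. $d(x,y)\le r$ abbreviates $(\exists z_0,\ldots,z_r)\,z_0=x\land z_r=y\land\bigwedge_{i=1}^r(z_{i-1}=z_i\lor e(z_{i-1},z_i))$, and $d(x,y)>r$ its negation. An $r$-local formula is a formula $\psi$ with one free variable $x$ all of whose quantifiers are of the form $(\exists y:d(x,y)\le r)$ or $(\forall y:d(x,y)\le r)$. A basic existential sentence is $(\exists x_1,\ldots,x_m)\bigwedge_{1\le i<j\le m}d(x_i,x_j)>2r\land\bigwedge_{i=1}^m\psi(x_i)$ and a basic universal sentence is $(\forall x_1,\ldots,x_{m+1})\bigwedge_{1\le i<j\le m+1}d(x_i,x_j)>2r\Rightarrow\bigvee_{i=1}^{m+1}\psi(x_i)$,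 with $\psi$ $r$-local; $m$ is the spread, $r$ the range, $\psi$ the core. A basic conjunction is a conjunction of basic existential and basic universal sentences; its spread and range are the maxima of those of its terms. For a basic existential/universal $\varphi_i$ (spread $m_i$, range $r_i$, core $\psi$) and $0\le k\le m_i$, the $(C,M,k)$-variant $\varphi_i^{(k)}$ is $(\exists x_1,\ldots,x_k)\bigwedge_{1\le a<b\le k}d(x_a,x_b)>2r_i\land\bigwedge_{a=1}^k(C(x_a)\land\psi(x_a))$ in the existential case and $(\forall x_1,\ldots,x_{k+1})\bigl(\bigwedge_{a=1}^{k+1}M(x_a)\land\bigwedge_{1\le a<b\le k+1}d(x_a,x_b)>2r_i\bigr)\Rightarrow\bigvee_{a=1}^{k+1}\psi(x_a)$ in the universal case. For $\varphi=\bigwedge_{i=1}^t\varphi_i$ and $q=(q_1,\ldots,q_t)$, $\varphi^{(q)}=\bigwedge_{i=1}^t\varphi_i^{(q_i)}$. For integers $\ell\ge2r+1$ and $n$, the $(\ell,r)$-cover of integers determined by $n$ is the set of all intervals $\{i,\ldots,i+\ell-1\}$ with $i\equiv n\pmod{\ell-2r}$ (there are exactly $\ell-2r$ distinct $(\ell,r)$-covers). For $I=\{i,\ldots,i+\ell-1\}$ and $d\ge0$, $M_d(I)=\{i+d,\ldots,i+\ell-d-1\}$. An $m$-plan for a cover $R$ is a function $p:R\to\mathbb{Z}_{\ge0}$ with $\sum_{I\in R}p(I)=m$.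
   Formalization: The parameters ε₁ and ε₂ are positive rationals instead of positive reals; the real case follows by approximating them from above by rationals. -}

module Defs where

open import Data.Nat as ℕ using (ℕ; zero; suc; _<ᵇ_; _⊔_)
open import Data.Bool using (Bool; true; false; not; if_then_else_; _∧_)
open import Data.Fin using (Fin; zero; suc; toℕ; fromℕ)
open import Data.Fin.Subset as Sub using (Subset; _∈_; _⊆_; _∩_; ∣_∣; ⋃)
open import Data.Vec using (tabulate)
open import Data.List using (List; map; upTo; allFin)
open import Data.Nat.ListAction using (sum)
open import Data.Maybe using (Maybe; just; nothing; fromMaybe; Is-just)
open import Data.Integer as ℤ using (ℤ; +_)
import Data.Integer.Properties as ℤP
open import Data.Rational as ℚ using (ℚ)
open import Data.Rational.Properties using (pos⇒nonZero)
open import Data.Product using (Σ; _×_; _,_)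
open import Data.Sum using (_⊎_)
open import Data.Unit using (⊤)
open import Data.Empty using (⊥)
open import Relation.Nullary using (¬_)
open import Relation.Nullary.Decidable using (⌊_⌋)
open import Relation.Binary.PropositionalEquality using (_≡_)

-- First-order syntax over a graph language with w unary symbols
-- (symbols Fin w), binary symbol e, equality; de Bruijn variables Fin v.

data Formula (w : ℕ) : ℕ → Set where
  tt ff : ∀ {v} → Formula w v
  eq    : ∀ {v} → Fin v → Fin v → Formula w v
  adj   : ∀ {v} → Fin v → Fin v → Formula w v
  pred  : ∀ {v} → Fin w → Fin v → Formula w v
  neg   : ∀ {v} → Formula w v → Formula w v
  and or : ∀ {v} → Formula w v → Formula w v → Formula w v
  ex all : ∀ {v} → Formula w (suc v) → Formula w v  -- binds variable zero

Sentence : ℕ → Set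
Sentence w = Formula w 0

_⇒_ : ∀ {w v} → Formula w v → Formula w v → Formula w v
a ⇒ b = or (neg a) b

lift : ∀ {v v'} → (Fin v → Fin v') → Fin (suc v) → Fin (suc v')
lift ρ zero = zero
lift ρ (suc i) = suc (ρ i)

rename : ∀ {w v v'} → (Fin v → Fin v') → Formula w v → Formula w v'
rename ρ tt = tt
rename ρ ff = ff
rename ρ (eq x y) = eq (ρ x) (ρ y)
rename ρ (adj x y) = adj (ρ x) (ρ y)
rename ρ (pred s x) = pred s (ρ x)
rename ρ (neg φ) = neg (rename ρ φ)
rename ρ (and φ ψ) = and (rename ρ φ) (rename ρ ψ)
rename ρ (or φ ψ) = or (rename ρ φ) (rename ρ ψ)
rename ρ (ex φ) = ex (rename (lift ρ) φ)
rename ρ (all φ) = all (rename (lift ρ) φ)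

mapSym : ∀ {w w' v} → (Fin w → Fin w') → Formula w v → Formula w' v
mapSym σ tt = tt
mapSym σ ff = ff
mapSym σ (eq x y) = eq x y
mapSym σ (adj x y) = adj x y
mapSym σ (pred s x) = pred (σ s) x
mapSym σ (neg φ) = neg (mapSym σ φ)
mapSym σ (and φ ψ) = and (mapSym σ φ) (mapSym σ ψ)
mapSym σ (or φ ψ) = or (mapSym σ φ) (mapSym σ ψ)
mapSym σ (ex φ) = ex (mapSym σ φ)
mapSym σ (all φ) = all (mapSym σ φ)

distLe : ∀ {w v} → ℕ → Fin v → Fin v → Formula w v
distLe zero x y = eq x y
distLe (suc r) x y = ex (and (distLe r (suc x) zero) (or (eq zero (suc y)) (adj zero (suc y))))

distGt : ∀ {w v} → ℕ → Fin v → Fin v → Formula w v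
distGt r x y = neg (distLe r x y)

andFin : ∀ {w v} (k : ℕ) → (Fin k → Formula w v) → Formula w v
andFin zero f = tt
andFin (suc k) f = and (f zero) (andFin k (λ i → f (suc i)))

orFin : ∀ {w v} (k : ℕ) → (Fin k → Formula w v) → Formula w v
orFin zero f = ff
orFin (suc k) f = or (f zero) (orFin k (λ i → f (suc i)))

andPairs : ∀ {w v} (k : ℕ) → (Fin k → Fin k → Formula w v) → Formula w v
andPairs k f = andFin k (λ b → andFin k (λ a → if toℕ a <ᵇ toℕ b then f a b else tt))

exN : ∀ {w} (k : ℕ) → Formula w k → Sentence w
exN zero φ = φ
exN (suc k) φ = exN k (ex φ)

allN : ∀ {w} (k : ℕ) → Formula w k → Sentence w
allN zero φ = φ
allN (suc k) φ = allN k (all φ)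

-- r-local formulas with one free variable x.  In a context of v bound
-- variables (besides x) the variables are Fin (suc v) and x is the last
-- one, fromℕ v.  All quantifiers are (∃ y : d(x,y) ≤ r) / (∀ y : d(x,y) ≤ r).

data Local (w r : ℕ) : ℕ → Set where
  ltt lff : ∀ {v} → Local w r v
  leq     : ∀ {v} → Fin (suc v) → Fin (suc v) → Local w r v
  ladj    : ∀ {v} → Fin (suc v) → Fin (suc v) → Local w r v
  lpred   : ∀ {v} → Fin w → Fin (suc v) → Local w r v
  lneg    : ∀ {v} → Local w r v → Local w r v
  land lor : ∀ {v} → Local w r v → Local w r v → Local w r v
  lex lall : ∀ {v} → Local w r (suc v) → Local w r v

toF : ∀ {w r v} → Local w r v → Formula w (suc v)
toF ltt = tt
toF lff = ff
toF (leq x y) = eq x y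
toF (ladj x y) = adj x y
toF (lpred s x) = pred s x
toF (lneg φ) = neg (toF φ)
toF (land φ ψ) = and (toF φ) (toF ψ)
toF (lor φ ψ) = or (toF φ) (toF ψ)
toF {r = r} {v = v} (lex φ) = ex (and (distLe r (fromℕ (suc v)) zero) (toF φ))
toF {r = r} {v = v} (lall φ) = all (distLe r (fromℕ (suc v)) zero ⇒ toF φ)

apply : ∀ {w r v} → Local w r 0 → Fin v → Formula w v
apply ψ y = rename (λ _ → y) (toF ψ)

-- X-positivity.  In the language L ∪ {X} (symbols Fin (suc u)) X is zero.

Occ : ∀ {u v} → Bool → Formula (suc u) v → Set
Occ b tt = ⊤
Occ b ff = ⊤
Occ b (eq _ _) = ⊤
Occ b (adj _ _) = ⊤
Occ b (pred zero _) = b ≡ true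
Occ b (pred (suc _) _) = ⊤
Occ b (neg φ) = Occ (not b) φ
Occ b (and φ ψ) = Occ b φ × Occ b ψ
Occ b (or φ ψ) = Occ b φ × Occ b ψ
Occ b (ex φ) = Occ b φ
Occ b (all φ) = Occ b φ

XPositive : ∀ {u v} → Formula (suc u) v → Set
XPositive = Occ true

data Kind : Set where
  existential universal : Kind

record Basic (u : ℕ) : Set where
  field
    kind   : Kind
    spread : ℕ
    range  : ℕ
    core   : Local (suc u) range 0
open Basic public

basicSentence : ∀ {u} → Basic u → Sentence (suc u)
basicSentence β with kind β
... | existential = exN m (and (andPairs m (λ a b → distGt (2 ℕ.* range β) a b))
                             (andFin m (λ a → apply (core β) a)))
  where m = spread β
... | universal = allN (suc m) (andPairs (suc m) (λ a b → distGt (2 ℕ.* range β) a b)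
                             ⇒ orFin (suc m) (λ a → apply (core β) a))
  where m = spread β

record BasicConj (u : ℕ) : Set where
  field
    t     : ℕ
    terms : Fin t → Basic u
open BasicConj public

maxFin : (k : ℕ) → (Fin k → ℕ) → ℕ
maxFin zero f = 0
maxFin (suc k) f = f zero ⊔ maxFin k (λ i → f (suc i))

sentence : ∀ {u} → BasicConj u → Sentence (suc u)
sentence φ = andFin (t φ) (λ i → basicSentence (terms φ i))

spreadOf rangeOf : ∀ {u} → BasicConj u → ℕ
spreadOf φ = maxFin (t φ) (λ i → spread (terms φ i))
rangeOf φ = maxFin (t φ) (λ i → range (terms φ i))

-- (C,M,k)-variants.  Language L ∪ {C,M} ∪ {X}: symbols Fin (3 + u),
-- X = 0, C = 1, M = 2, L-symbol j = 3 + j.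

embedXL : ∀ {u} → Fin (suc u) → Fin (suc (suc (suc u)))
embedXL zero = zero
embedXL (suc j) = suc (suc (suc j))

symC symM : ∀ {u} → Fin (suc (suc (suc u)))
symC = suc zero
symM = suc (suc zero)

variant : ∀ {u} → Basic u → ℕ → Sentence (suc (suc (suc u)))
variant β k with kind β
... | existential = exN k (and (andPairs k (λ a b → distGt (2 ℕ.* range β) a b))
                       (andFin k (λ a → and (pred symC a) (mapSym embedXL (apply (core β) a)))))
... | universal = allN (suc k) (and (andFin (suc k) (λ a → pred symM a))
                                    (andPairs (suc k) (λ a b → distGt (2 ℕ.* range β) a b))
                       ⇒ orFin (suc k) (λ a → mapSym embedXL (apply (core β) a)))

variantConj : ∀ {u} (φ : BasicConj u) → (Fin (t φ) → ℕ) → Sentence (suc (suc (suc u)))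
variantConj φ q = andFin (t φ) (λ i → variant (terms φ i) (q i))

-- Interpretations.  Finite vertex set Fin n; the domain of the
-- interpretation is the subset dom (so induced substructures G[S] keep
-- the ambient vertex numbering); unary symbol s is interpreted by P s.

record Interp (w : ℕ) : Set where
  field
    n   : ℕ
    dom : Subset n
    E   : Fin n → Fin n → Bool
    P   : Fin w → Subset n
open Interp public

_,:=_ : ∀ {w} (H : Interp w) → Subset (n H) → Interp (suc w)
H ,:= A = record { n = n H ; dom = dom H ; E = E H ; P = P' }
  where
  P' : Fin (suc _) → Subset (n H)
  P' zero = A
  P' (suc s) = P H s

_[_] : ∀ {w} (H : Interp w) → Subset (n H) → Interp w
H [ S ] = record { n = n H ; dom = dom H ∩ S ; E = E H ; P = λ s → P H s ∩ S }

ext : ∀ {v} {A : Set} → (Fin v → A) → A → Fin (suc v) → A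
ext ρ a zero = a
ext ρ a (suc i) = ρ i

Sat : ∀ {w v} (H : Interp w) → Formula w v → (Fin v → Fin (n H)) → Set
Sat H tt ρ = ⊤
Sat H ff ρ = ⊥
Sat H (eq x y) ρ = ρ x ≡ ρ y
Sat H (adj x y) ρ = E H (ρ x) (ρ y) ≡ true
Sat H (pred s x) ρ = ρ x ∈ P H s
Sat H (neg φ) ρ = ¬ Sat H φ ρ
Sat H (and φ ψ) ρ = Sat H φ ρ × Sat H ψ ρ
Sat H (or φ ψ) ρ = Sat H φ ρ ⊎ Sat H ψ ρ
Sat H (ex φ) ρ = Σ (Fin (n H)) λ a → a ∈ dom H × Sat H φ (ext ρ a)
Sat H (all φ) ρ = (a : Fin (n H)) → a ∈ dom H → Sat H φ (ext ρ a)

_⊨_ : ∀ {w} (H : Interp w) → Sentence w → Set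
H ⊨ θ = Sat H θ (λ ())

IsGamma : ∀ {w} (H : Interp w) → Sentence (suc w) → ℕ → Set
IsGamma H θ g =
  (Σ (Subset (n H)) λ A → A ⊆ dom H × (H ,:= A) ⊨ θ × ∣ A ∣ ≡ g) ×
  ((A : Subset (n H)) → A ⊆ dom H → (H ,:= A) ⊨ θ → g ℕ.≤ ∣ A ∣)

record LGraph (u : ℕ) : Set where
  field
    N      : ℕ
    adjG   : Fin N → Fin N → Bool
    symm   : ∀ x y → adjG x y ≡ adjG y x
    irrefl : ∀ x → adjG x x ≡ false
    preds  : Fin u → Subset N
open LGraph public

asInterp : ∀ {u} → LGraph u → Interp u
asInterp G = record { n = N G ; dom = Sub.⊤ ; E = adjG G ; P = preds G }

IsLayering : ∀ {u} (G : LGraph u) → (Fin (N G) → ℤ) → Set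
IsLayering G λ' = ∀ x y → adjG G x y ≡ true → ℤ.∣ λ' x ℤ.- λ' y ∣ ℕ.≤ 1

preimage : ∀ {k} → (Fin k → ℤ) → ℤ → ℤ → Subset k
preimage λ' lo hi = tabulate (λ x → ⌊ lo ℤP.≤? λ' x ⌋ ∧ ⌊ λ' x ℤP.≤? hi ⌋)

-- interval I = {i, …, i+ℓ-1} given by i;  M_d(I) = {i+d, …, i+ℓ-d-1}
Mset : ∀ {k} → (Fin k → ℤ) → ℕ → ℤ → ℕ → Subset k
Mset λ' ℓ i d = preimage λ' (i ℤ.+ + d) (i ℤ.+ + ℓ ℤ.- + d ℤ.- + 1)

-- G_I = G[λ⁻¹(I)], C := λ⁻¹(M_{2r}(I)), M := λ⁻¹(M_r(I))   (C = 1, M = 2 once X = 0 is added)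
G_I : ∀ {u} (G : LGraph u) → (Fin (N G) → ℤ) → (ℓ r : ℕ) → ℤ → Interp (suc (suc u))
G_I G λ' ℓ r i = ((asInterp G [ Mset λ' ℓ i 0 ]) ,:= Mset λ' ℓ i r) ,:= Mset λ' ℓ i (2 ℕ.* r)

-- Covers, plans.  The (ℓ,r)-cover determined by c ∈ ℤ is indexed by
-- k ∈ ℤ: its k-th interval starts at c + k(ℓ-2r).

start : (ℓ r : ℕ) → ℤ → ℤ → ℤ
start ℓ r c k = c ℤ.+ k ℤ.* + (ℓ ℕ.∸ 2 ℕ.* r)

window : ℕ → List ℤ
window B = map (λ j → + j ℤ.- + B) (upTo (suc (2 ℕ.* B)))

sumZ : ℕ → (ℤ → ℕ) → ℕ
sumZ B f = sum (map f (window B))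

-- p : ℤ → ℕ (a function on the intervals of the cover) is an m-plan:
-- finitely supported with total sum m
IsPlan : ℕ → (ℤ → ℕ) → Set
IsPlan m p = Σ ℕ λ B → ((k : ℤ) → B ℕ.< ℤ.∣ k ∣ → p k ≡ 0) × sumZ B p ≡ m

toℚ : ℕ → ℚ
toℚ k = + k ℚ./ 1

twoOver : (ε : ℚ) → ℚ.Positive ε → ℚ
twoOver ε pos = (toℚ 2 ℚ.÷ ε) {{pos⇒nonZero ε {{pos}}}}

module Setup {u : ℕ} (φ : BasicConj u) (G : LGraph u) (λ' : Fin (N G) → ℤ)
             (ℓ : ℕ) (ε₁ : ℚ) where

  r : ℕ
  r = rangeOf φ

  Tuple : Set
  Tuple = Fin (t φ) → ℕ

  GI : ℤ → Interp (suc (suc u))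
  GI i = G_I G λ' ℓ r i

  -- specification of A_{I,q} (I given by its first element i)
  ChoiceSpec : ℤ → Tuple → Maybe (Subset (N G)) → Set
  ChoiceSpec i q nothing = ¬ ((GI i ,:= dom (GI i)) ⊨ variantConj φ q)
  ChoiceSpec i q (just A) =
    A ⊆ dom (GI i) × (GI i ,:= A) ⊨ variantConj φ q ×
    ((g : ℕ) → IsGamma (GI i) (variantConj φ q) g →
       toℚ ∣ A ∣ ℚ.≤ (ℚ.1ℚ ℚ.+ ε₁) ℚ.* toℚ g)

  Chooser : Set
  Chooser = ℤ → Tuple → Maybe (Subset (N G))

  ValidChooser : Chooser → Set
  ValidChooser ch = (i : ℤ) (q : Tuple) → (∀ j → q j ℕ.≤ spread (terms φ j)) →
                    ChoiceSpec i q (ch i q)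

  -- a cover (given by c) together with a t-tuple of plans p
  CovPlan : Set
  CovPlan = ℤ × (Fin (t φ) → ℤ → ℕ)

  module _ (ch : Chooser) where

    A_I : CovPlan → ℤ → Maybe (Subset (N G))
    A_I (c , p) k = ch (start ℓ r c k) (λ j → p j k)

    -- every interval meeting λ(V) has index k with ∣k∣ ≤ bound
    bound : CovPlan → ℕ
    bound (c , p) = sum (map (λ x → ℤ.∣ λ' x ∣) (allFin (N G))) ℕ.+ ℤ.∣ c ∣ ℕ.+ ℓ

    Defined : CovPlan → Set
    Defined cp = (k : ℤ) → Is-just (A_I cp k)

    -- A_{R,p} = ⋃_{I ∈ R} A_{I,p(I)}   (the A_{I,p(I)} ⊆ λ⁻¹(I) vanish for ∣k∣ > bound)
    A_Rp : CovPlan → Subset (N G)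
    A_Rp cp = ⋃ (map (λ k → fromMaybe Sub.⊥ (A_I cp k)) (window (bound cp)))

    a_Rp : CovPlan → ℕ
    a_Rp cp = sumZ (bound cp) (λ k → ∣ fromMaybe Sub.⊥ (A_I cp k) ∣)

    Candidate : CovPlan → Set
    Candidate (c , p) = ((j : Fin (t φ)) → IsPlan (spread (terms φ j)) (p j)) × Defined (c , p)

    -- specification of the choice of A (as a choice of minimising R, p)
    SelSpec : Maybe CovPlan → Set
    SelSpec nothing = ¬ (Σ CovPlan Candidate)
    SelSpec (just cp) = Candidate cp × ((cp' : CovPlan) → Candidate cp' → a_Rp cp ℕ.≤ a_Rp cp')

{-# OPTIONS --safe #-}
module Submission where

-- Write d = ℓ - 2r.  Local solutions glue to a global one: the sets M_2r(I) of
-- different intervals are more than 2r apart, so existential witnesses add up,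
-- and the sets M_r(I) partition the layers, so universal terms follow by pigeonhole.
--
-- Conversely, let A be a global solution.  To each term belong at most m anchors:
-- the witnesses of an existential term, or a maximal far-apart set of vertices
-- violating the core of a universal term.  At most 6r of the d covers have an
-- overlap of consecutive intervals near a given anchor, so more than half of the
-- covers are good for all anchors.  On a good cover all relevant vertices of
-- M_r(I) lie in M_2r(I), so restricting A to the intervals yields plans, and
-- Σ |A ∩ λ⁻¹(I)| exceeds |A| by 2r|A|/d on average over all covers, hence by at
-- most 4r|A|/d on some good one.

open import Defs
open import Algebra.Properties.AbelianGroup using (∙-cancelˡ; ∙-cancelʳ)
open import Data.Bool as Bool using (Bool; true; false; not; _∧_)
import Data.Bool.Properties as BoolP
open import Data.Fin as F using (Fin; zero; suc; toℕ; fromℕ)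
import Data.Fin.Properties as FP
open import Data.Fin.Subset as Sub using (Subset; ∣_∣; _⊆_; _∩_; _∪_; ⋃)
  renaming (_∈_ to _∈ˢ_)
import Data.Fin.Subset.Properties as SubP
open import Data.Integer as ℤ using (ℤ; +_; -[1+_]; +≤+; -≤+; +<+)
import Data.Integer.DivMod as DivMod
import Data.Integer.Properties as ℤP
import Data.Integer.Tactic.RingSolver as ℤSolver
open import Data.List
  using (List; []; _∷_; length; lookup; tabulate; map; filter; take; concat; upTo; allFin)
import Data.List.Properties as ListP
import Data.List.Membership.DecPropositional as DecMembership
open import Data.List.Membership.Propositional using (_∈_; _∉_; lose; find)
open import Data.List.Membership.Propositional.Properties
  using (∈-lookup; ∈-map⁺; ∈-upTo⁺; ∈-upTo⁻; ∈-filter⁻; ∈-concat⁺′; ∈-allFin)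
open import Data.List.Relation.Unary.All as All using (All; []; _∷_)
import Data.List.Relation.Unary.All.Properties as AllP
open import Data.List.Relation.Unary.AllPairs as AllPairs using (AllPairs; []; _∷_)
import Data.List.Relation.Unary.AllPairs.Properties as AllPairsP
open import Data.List.Relation.Unary.Any as Any using (Any; here; there)
import Data.List.Relation.Unary.Any.Properties as AnyP
open import Data.List.Relation.Unary.Unique.Propositional using (Unique)
import Data.List.Relation.Unary.Unique.Propositional.Properties as UniqueP
open import Data.Maybe using (Maybe; just; nothing; fromMaybe; Is-just)
open import Data.Maybe.Relation.Unary.Any using (just)
open import Data.Nat as ℕ using (ℕ; zero; suc; z≤n; s≤s)
open import Data.Nat.Induction using (<-wellFounded)
open import Data.Nat.ListAction using (sum)
import Data.Nat.Properties as ℕP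
import Data.Nat.Tactic.RingSolver as ℕSolver
open import Data.Product using (Σ; _×_; _,_; proj₁; proj₂; map₂)
open import Data.Product.Function.NonDependent.Propositional using (_×-⇔_)
open import Data.Rational as ℚ using (ℚ; Positive; NonNegative; 1ℚ; 1/_; positive; nonNegative)
import Data.Rational.Properties as ℚP
open import Data.Rational.Solver using (module +-*-Solver)
open import Data.Rational.Unnormalised as ℚᵘ using (mkℚᵘ; *≡*; *≤*; *<*)
import Data.Rational.Unnormalised.Properties as ℚᵘP
open import Data.Sum as Sum using (_⊎_; inj₁; inj₂)
open import Data.Sum.Function.Propositional using (_⊎-⇔_)
open import Data.Unit using (tt)
import Data.Vec as Vec
import Data.Vec.Properties as VecP
open import Function using (_∘_; id; const; _⇔_; mk⇔)
open import Function.Bundles using (Equivalence)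
import Function.Properties.Equivalence as Eqv
open import Induction.WellFounded using (Acc; acc)
open import Relation.Binary using (DecidableEquality; tri<; tri≈; tri>)
open import Relation.Binary.PropositionalEquality
  using (_≡_; _≢_; refl; sym; trans; cong; cong₂; subst; subst₂; module ≡-Reasoning)
open import Relation.Nullary using (¬_; Dec; yes; no; contradiction)
open import Relation.Nullary.Decidable using (¬?; _×-dec_; _⊎-dec_; _→-dec_; map′; ⌊_⌋)
open import Relation.Unary using (Decidable)
open +-*-Solver using (solve; _:=_; _:+_; _:*_; :-_; con)
open Equivalence using (to; from)

-- The bound on ℓ says that d > 12rmt and d > 4r/ε₂. At most tm anchors spoil 6r covers each, so by
-- the first inequality fewer than half of the covers are bad; the second turns an excess of 4r|A|/d
-- into at most ε₂|A|. What is averaged over the good covers is the excess Σ |A ∩ λ⁻¹(I)| - |A|, not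
-- the sum: the excess is non-negative, so discarding the bad covers at most doubles its average,
-- while averaging the sum itself would double |A| as well. One cover must suit all terms, so the
-- anchors are fixed before the cover. The vertices that violate a universal core inside the
-- intervals depend on the cover, but those in M_r(I) also violate it in G, and by maximality each
-- lies within 2r of an anchor. On a good cover, maximal far-apart sets of such vertices in the
-- separate intervals unite to a far-apart set of G; their sizes therefore sum to at most m_i, and
-- the remainder of the plan goes to a single interval. Positivity enters in gluing, where A_{R,p}
-- can contain more of an interval than the A_{I,q} chosen for it.

-- Semantics of sentences, distances, basic sentences and their variants.

module Semantics where

  open import Data.Nat using (_≤_; _<_)

  ¬-⇔ : ∀ {A B : Set} → A ⇔ B → (¬ A) ⇔ (¬ B)
  ¬-⇔ e = mk⇔ (_∘ from e) (_∘ to e)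

  →-⇔ : ∀ {A B C D : Set} → A ⇔ B → C ⇔ D → (A → C) ⇔ (B → D)
  →-⇔ e f = mk⇔ (λ g → to f ∘ g ∘ from e) (λ g → from f ∘ g ∘ to e)

  Σ-⇔ : ∀ {A : Set} {P Q : A → Set} → (∀ a → P a ⇔ Q a) → Σ A P ⇔ Σ A Q
  Σ-⇔ e = mk⇔ (map₂ (to (e _))) (map₂ (from (e _)))

  Π-⇔ : ∀ {A : Set} {P Q : A → Set} → (∀ a → P a ⇔ Q a) → (∀ a → P a) ⇔ (∀ a → Q a)
  Π-⇔ e = mk⇔ (λ f a → to (e a) (f a)) (λ f a → from (e a) (f a))

  ≡-⇔ : ∀ {A : Set} {a a' b b' : A} → a ≡ a' → b ≡ b' → (a ≡ b) ⇔ (a' ≡ b')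
  ≡-⇔ refl refl = Eqv.refl

  infixr 2 _⇔∘_
  _⇔∘_ : ∀ {A B C : Set} → A ⇔ B → B ⇔ C → A ⇔ C
  _⇔∘_ = Eqv.trans

  ext-cong : ∀ {v} {A : Set} {ρ ρ' : Fin v → A} {a} →
    (∀ i → ρ i ≡ ρ' i) → ∀ i → ext ρ a i ≡ ext ρ' a i
  ext-cong h zero = refl
  ext-cong h (suc i) = h i

  ext-lift : ∀ {v v'} {A : Set} {σ : Fin v → Fin v'} {ρ : Fin v → A} {ρ' : Fin v' → A} {a} →
    (∀ i → ρ' (σ i) ≡ ρ i) → ∀ i → ext ρ' a (lift σ i) ≡ ext ρ a i
  ext-lift h zero = refl
  ext-lift h (suc i) = h i

  Sat-cong : ∀ {w v} (H : Interp w) (φ : Formula w v) {ρ ρ' : Fin v → Fin (n H)} →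
    (∀ i → ρ i ≡ ρ' i) → Sat H φ ρ ⇔ Sat H φ ρ'
  Sat-cong H tt h = Eqv.refl
  Sat-cong H ff h = Eqv.refl
  Sat-cong H (eq x y) h = ≡-⇔ (h x) (h y)
  Sat-cong H (adj x y) h = ≡-⇔ (cong₂ (E H) (h x) (h y)) refl
  Sat-cong H (pred s x) h =
    mk⇔ (subst (_∈ˢ P H s) (h x)) (subst (_∈ˢ P H s) (sym (h x)))
  Sat-cong H (neg φ) h = ¬-⇔ (Sat-cong H φ h)
  Sat-cong H (and φ ψ) h = Sat-cong H φ h ×-⇔ Sat-cong H ψ h
  Sat-cong H (or φ ψ) h = Sat-cong H φ h ⊎-⇔ Sat-cong H ψ h
  Sat-cong H (ex φ) h = Σ-⇔ λ a → Eqv.refl ×-⇔ Sat-cong H φ (ext-cong h)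
  Sat-cong H (all φ) h = Π-⇔ λ a → →-⇔ Eqv.refl (Sat-cong H φ (ext-cong h))

  Sat-rename : ∀ {w v v'} (H : Interp w) (σ : Fin v → Fin v') (φ : Formula w v)
    {ρ : Fin v → Fin (n H)} {ρ' : Fin v' → Fin (n H)} →
    (∀ i → ρ' (σ i) ≡ ρ i) → Sat H (rename σ φ) ρ' ⇔ Sat H φ ρ
  Sat-rename H σ tt h = Eqv.refl
  Sat-rename H σ ff h = Eqv.refl
  Sat-rename H σ (eq x y) h = ≡-⇔ (h x) (h y)
  Sat-rename H σ (adj x y) h = ≡-⇔ (cong₂ (E H) (h x) (h y)) refl
  Sat-rename H σ (pred s x) h =
    mk⇔ (subst (_∈ˢ P H s) (h x)) (subst (_∈ˢ P H s) (sym (h x)))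
  Sat-rename H σ (neg φ) h = ¬-⇔ (Sat-rename H σ φ h)
  Sat-rename H σ (and φ ψ) h = Sat-rename H σ φ h ×-⇔ Sat-rename H σ ψ h
  Sat-rename H σ (or φ ψ) h = Sat-rename H σ φ h ⊎-⇔ Sat-rename H σ ψ h
  Sat-rename H σ (ex φ) h =
    Σ-⇔ λ a → Eqv.refl ×-⇔ Sat-rename H (lift σ) φ (ext-lift h)
  Sat-rename H σ (all φ) h =
    Π-⇔ λ a → →-⇔ Eqv.refl (Sat-rename H (lift σ) φ (ext-lift h))

  reduct : ∀ {w w'} → (Fin w → Fin w') → Interp w' → Interp w
  reduct σ H = record { n = n H ; dom = dom H ; E = E H ; P = P H ∘ σ }

  Sat-mapSym : ∀ {w w' v} (H : Interp w') (σ : Fin w → Fin w') (φ : Formula w v)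
    {ρ : Fin v → Fin (n H)} → Sat H (mapSym σ φ) ρ ⇔ Sat (reduct σ H) φ ρ
  Sat-mapSym H σ tt = Eqv.refl
  Sat-mapSym H σ ff = Eqv.refl
  Sat-mapSym H σ (eq x y) = Eqv.refl
  Sat-mapSym H σ (adj x y) = Eqv.refl
  Sat-mapSym H σ (pred s x) = Eqv.refl
  Sat-mapSym H σ (neg φ) = ¬-⇔ (Sat-mapSym H σ φ)
  Sat-mapSym H σ (and φ ψ) = Sat-mapSym H σ φ ×-⇔ Sat-mapSym H σ ψ
  Sat-mapSym H σ (or φ ψ) = Sat-mapSym H σ φ ⊎-⇔ Sat-mapSym H σ ψ
  Sat-mapSym H σ (ex φ) = Σ-⇔ λ a → Eqv.refl ×-⇔ Sat-mapSym H σ φ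
  Sat-mapSym H σ (all φ) = Π-⇔ λ a → →-⇔ Eqv.refl (Sat-mapSym H σ φ)

  Sat? : ∀ {w v} (H : Interp w) (φ : Formula w v) (ρ : Fin v → Fin (n H)) → Dec (Sat H φ ρ)
  Sat? H tt ρ = yes tt
  Sat? H ff ρ = no λ ()
  Sat? H (eq x y) ρ = ρ x FP.≟ ρ y
  Sat? H (adj x y) ρ = E H (ρ x) (ρ y) Bool.≟ true
  Sat? H (pred s x) ρ = ρ x SubP.∈? P H s
  Sat? H (neg φ) ρ = ¬? (Sat? H φ ρ)
  Sat? H (and φ ψ) ρ = Sat? H φ ρ ×-dec Sat? H ψ ρ
  Sat? H (or φ ψ) ρ = Sat? H φ ρ ⊎-dec Sat? H ψ ρ
  Sat? H (ex φ) ρ = FP.any? λ a → (a SubP.∈? dom H) ×-dec Sat? H φ (ext ρ a)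
  Sat? H (all φ) ρ = FP.all? λ a → (a SubP.∈? dom H) →-dec Sat? H φ (ext ρ a)

  -- `ChoiceSpec` bounds a chosen set only against numbers that satisfy `IsGamma`. Satisfaction is
  -- decidable, so a smaller solution can be searched for, and descent on the size reaches the
  -- minimum.
  IsGamma-exists : ∀ {w} (H : Interp w) (θ : Sentence (suc w)) (A : Subset (n H)) →
    A ⊆ dom H → (H ,:= A) ⊨ θ → Σ ℕ λ g → IsGamma H θ g × g ≤ ∣ A ∣
  IsGamma-exists H θ A A⊆ sat = go A A⊆ sat (<-wellFounded ∣ A ∣)
    where
    go : ∀ A → A ⊆ dom H → (H ,:= A) ⊨ θ → Acc _<_ ∣ A ∣ →
         Σ ℕ λ g → IsGamma H θ g × g ≤ ∣ A ∣
    go A A⊆ sat (acc smaller)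
      with SubP.anySubset? (λ A' → (A' SubP.⊆? dom H) ×-dec
             Sat? (H ,:= A') θ (λ ()) ×-dec (∣ A' ∣ ℕP.<? ∣ A ∣))
    ... | yes (A' , A'⊆ , sat' , lt) with go A' A'⊆ sat' (smaller lt)
    ...   | g , isγ , g≤ = g , isγ , ℕP.≤-trans g≤ (ℕP.<⇒≤ lt)
    go A A⊆ sat _ | no none =
      ∣ A ∣ , ((A , (λ {x} → A⊆ {x}) , sat , refl) ,
        λ A' A'⊆ sat' → ℕP.≮⇒≥ λ lt → none (A' , A'⊆ , sat' , lt)) , ℕP.≤-refl

  -- The semantic counterpart of `distLe`: a walk whose vertices before the last are quantified,
  -- hence lie in the domain. The endpoint is a free variable and is not tested, which is why `Ball`
  -- asks for its membership separately.
  Dist : ∀ {w} (H : Interp w) → ℕ → Fin (n H) → Fin (n H) → Set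
  Dist H zero x y = x ≡ y
  Dist H (suc r) x y =
    Σ (Fin (n H)) λ z → z ∈ˢ dom H × Dist H r x z × (z ≡ y ⊎ E H z y ≡ true)

  Sat-distLe : ∀ {w v} (H : Interp w) r (x y : Fin v) {ρ : Fin v → Fin (n H)} →
    Sat H (distLe r x y) ρ ⇔ Dist H r (ρ x) (ρ y)
  Sat-distLe H zero x y = Eqv.refl
  Sat-distLe H (suc r) x y =
    Σ-⇔ λ z → Eqv.refl ×-⇔ (Sat-distLe H r (suc x) zero ×-⇔ Eqv.refl)

  Dist? : ∀ {w} (H : Interp w) r x y → Dec (Dist H r x y)
  Dist? H zero x y = x FP.≟ y
  Dist? H (suc r) x y = FP.any? λ z → (z SubP.∈? dom H) ×-dec
    Dist? H r x z ×-dec ((z FP.≟ y) ⊎-dec (E H z y Bool.≟ true))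

  Dist-refl : ∀ {w} (H : Interp w) r {x} → x ∈ˢ dom H → Dist H r x x
  Dist-refl H zero _ = refl
  Dist-refl H (suc r) x∈ = _ , x∈ , Dist-refl H r x∈ , inj₁ refl

  Far : ∀ {w} (H : Interp w) → ℕ → Fin (n H) → Fin (n H) → Set
  Far H r x y = ¬ Dist H r x y

  Sat-andFin : ∀ {w v} (H : Interp w) k (f : Fin k → Formula w v) {ρ : Fin v → Fin (n H)} →
    Sat H (andFin k f) ρ ⇔ (∀ a → Sat H (f a) ρ)
  Sat-andFin H zero f = mk⇔ (λ _ ()) _
  Sat-andFin H (suc k) f = mk⇔
    (λ { (p , q) zero → p ; (p , q) (suc a) → to (Sat-andFin H k _) q a })
    (λ h → h zero , from (Sat-andFin H k _) (h ∘ suc))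

  ⊨-andFin : ∀ {w} (H : Interp w) k (f : Fin k → Sentence w) →
    H ⊨ andFin k f ⇔ (∀ a → H ⊨ f a)
  ⊨-andFin H k f = Sat-andFin H k f

  Sat-orFin : ∀ {w v} (H : Interp w) k (f : Fin k → Formula w v) {ρ : Fin v → Fin (n H)} →
    Sat H (orFin k f) ρ ⇔ (Σ (Fin k) λ a → Sat H (f a) ρ)
  Sat-orFin H zero f = mk⇔ (λ ()) (λ ())
  Sat-orFin H (suc k) f = mk⇔
    (Sum.[ (zero ,_) , (λ q → let a , s = to (Sat-orFin H k _) q in suc a , s) ])
    (λ { (zero , s) → inj₁ s ; (suc a , s) → inj₂ (from (Sat-orFin H k _) (a , s)) })

  Sat-andPairs : ∀ {w v} (H : Interp w) k (f : Fin k → Fin k → Formula w v)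
    {ρ : Fin v → Fin (n H)} →
    Sat H (andPairs k f) ρ ⇔ (∀ a b → a F.< b → Sat H (f a b) ρ)
  Sat-andPairs H k f {ρ} = mk⇔
    (λ s a b lt → subst (λ c → Sat H (Bool.if c then f a b else tt) ρ)
       (to BoolP.T-≡ (ℕP.<⇒<ᵇ lt))
       (to (Sat-andFin H k _) (to (Sat-andFin H k _) s b) a))
    (λ h → from (Sat-andFin H k _) λ b → from (Sat-andFin H k _) λ a → guarded a b h)
    where
    guarded : ∀ a b {ρ} → (∀ a b → a F.< b → Sat H (f a b) ρ) →
      Sat H (Bool.if toℕ a ℕ.<ᵇ toℕ b then f a b else tt) ρ
    guarded a b h with toℕ a ℕ.<ᵇ toℕ b in e
    ... | true = h a b (ℕP.<ᵇ⇒< _ _ (from BoolP.T-≡ e))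
    ... | false = tt

  Sat-exN : ∀ {w} (H : Interp w) k (φ : Formula w k) {ρ₀ : Fin 0 → Fin (n H)} →
    Sat H (exN k φ) ρ₀ ⇔
    Σ (Fin k → Fin (n H)) λ ρ → (∀ a → ρ a ∈ˢ dom H) × Sat H φ ρ
  Sat-exN H zero φ = mk⇔ (λ s → _ , (λ ()) , s) (λ (_ , _ , s) → to (Sat-cong H φ λ ()) s)
  Sat-exN H (suc k) φ = Sat-exN H k (ex φ) ⇔∘ mk⇔
    (λ (ρ , ∈dom , a , a∈ , s) → ext ρ a , (λ { zero → a∈ ; (suc i) → ∈dom i }) , s)
    (λ (ρ , ∈dom , s) → ρ ∘ suc , ∈dom ∘ suc , ρ zero , ∈dom zero ,
       to (Sat-cong H φ λ { zero → refl ; (suc i) → refl }) s)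

  Sat-allN : ∀ {w} (H : Interp w) k (φ : Formula w k) {ρ₀ : Fin 0 → Fin (n H)} →
    Sat H (allN k φ) ρ₀ ⇔
    ((ρ : Fin k → Fin (n H)) → (∀ a → ρ a ∈ˢ dom H) → Sat H φ ρ)
  Sat-allN H zero φ = mk⇔ (λ s _ _ → to (Sat-cong H φ λ ()) s) (λ h → h _ λ ())
  Sat-allN H (suc k) φ = Sat-allN H k (all φ) ⇔∘ mk⇔
    (λ h ρ ∈dom → to (Sat-cong H φ λ { zero → refl ; (suc i) → refl })
       (h (ρ ∘ suc) (∈dom ∘ suc) (ρ zero) (∈dom zero)))
    (λ h ρ ∈dom a a∈ → h (ext ρ a) λ { zero → a∈ ; (suc i) → ∈dom i })

  Sat-⇒ : ∀ {w v} (H : Interp w) (φ ψ : Formula w v) {ρ : Fin v → Fin (n H)} →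
    Sat H (φ ⇒ ψ) ρ ⇔ (Sat H φ ρ → Sat H ψ ρ)
  Sat-⇒ H φ ψ {ρ} = mk⇔ Sum.[ (λ ¬a a → contradiction a ¬a) , const ] imp
    where
    imp : (Sat H φ ρ → Sat H ψ ρ) → Sat H (φ ⇒ ψ) ρ
    imp f with Sat? H φ ρ
    ... | yes a = inj₂ (f a)
    ... | no ¬a = inj₁ ¬a

  Holds : ∀ {w r} (H : Interp w) → Local w r 0 → Fin (n H) → Set
  Holds H ψ x = Sat H (toF ψ) (λ _ → x)

  Sat-apply : ∀ {w r v} (H : Interp w) (ψ : Local w r 0) (a : Fin v) {ρ : Fin v → Fin (n H)} →
    Sat H (apply ψ a) ρ ⇔ Holds H ψ (ρ a)
  Sat-apply H ψ a = Sat-rename H _ (toF ψ) λ _ → refl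

  -- Lists take the place of tuples of variables, so that `filter`, `take` and `concat` can split
  -- and join systems of far-apart vertices.
  Spread : ∀ {V : Set} → (V → V → Set) → (V → Set) → ℕ → Set
  Spread {V} R Q k = Σ (List V) λ xs → length xs ≡ k × AllPairs R xs × All Q xs

  -- Existential terms are read on `C`, universal ones on `M`; the unrelativised sentence is the
  -- case in which both are the whole domain. The list form of the universal case tests exactly
  -- `suc k` vertices.
  Meaning : ∀ {V : Set} → Kind → ℕ → (V → V → Set) → (C M ψ : V → Set) → Set
  Meaning existential k R C M ψ = Spread R (λ x → C x × ψ x) k
  Meaning {V} universal k R C M ψ =
    (xs : List V) → length xs ≡ suc k → AllPairs R xs → All M xs → Any ψ xs

  AllPairs-lookup : ∀ {V : Set} {R : V → V → Set} {xs} → AllPairs R xs →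
    ∀ {i j} → i F.< j → R (lookup xs i) (lookup xs j)
  AllPairs-lookup (x~ ∷ _) {zero} {suc j} _ = All.lookup x~ (∈-lookup j)
  AllPairs-lookup (_ ∷ ~) {suc i} {suc j} (s≤s lt) = AllPairs-lookup ~ lt

  module _ {V : Set} {R : V → V → Set} where

    Spread-tabulate : ∀ {Q : V → Set} {k} →
      (Σ (Fin k → V) λ ρ → (∀ a b → a F.< b → R (ρ a) (ρ b)) × (∀ a → Q (ρ a))) ⇔ Spread R Q k
    Spread-tabulate = mk⇔
      (λ (ρ , far , q) → tabulate ρ , ListP.length-tabulate ρ ,
         AllPairsP.tabulate⁺-< (far _ _) , AllP.tabulate⁺ q)
      (λ { (xs , refl , far , q) →
         lookup xs , (λ _ _ → AllPairs-lookup far) , λ a → All.lookup q (∈-lookup a) })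

    Meaning-universal-tabulate : ∀ {C M ψ : V → Set} {k} →
      ((ρ : Fin (suc k) → V) → (∀ a b → a F.< b → R (ρ a) (ρ b)) × (∀ a → M (ρ a)) →
        Σ (Fin (suc k)) λ a → ψ (ρ a)) ⇔ Meaning universal k R C M ψ
    Meaning-universal-tabulate {k = k} = mk⇔
      (λ { h xs@(x ∷ ys) refl far m →
         let a , s = h (lookup xs) ((λ _ _ → AllPairs-lookup far) , λ a → All.lookup m (∈-lookup a))
         in lose (∈-lookup a) s })
      (λ h ρ (far , m) → AnyP.tabulate⁻ (h (tabulate ρ) (ListP.length-tabulate ρ)
         (AllPairsP.tabulate⁺-< (far _ _)) (AllP.tabulate⁺ m)))

  module _ {w : ℕ} (H : Interp w) (d : ℕ) where

    farPairs : ∀ k → Formula w k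
    farPairs k = andPairs k (λ a b → distGt d a b)

    Sat-farPairs : ∀ k {ρ : Fin k → Fin (n H)} →
      Sat H (farPairs k) ρ ⇔ (∀ a b → a F.< b → Far H d (ρ a) (ρ b))
    Sat-farPairs k = Sat-andPairs H k _ ⇔∘ mk⇔
      (λ h a b lt → h a b lt ∘ from (Sat-distLe H d a b))
      (λ h a b lt → h a b lt ∘ to (Sat-distLe H d a b))

    Sat-existential : ∀ k (g : Fin k → Formula w k) {C ψ : Fin (n H) → Set} →
      (∀ ρ a → (ρ a ∈ˢ dom H × Sat H (g a) ρ) ⇔ (C (ρ a) × ψ (ρ a))) →
      H ⊨ exN k (and (farPairs k) (andFin k g)) ⇔ Spread (Far H d) (λ x → C x × ψ x) k
    Sat-existential k g body = Sat-exN H k _ ⇔∘ mk⇔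
      (λ (ρ , ∈dom , far , s) → ρ , to (Sat-farPairs k) far ,
         λ a → to (body ρ a) (∈dom a , to (Sat-andFin H k g) s a))
      (λ (ρ , far , q) → ρ , (λ a → proj₁ (from (body ρ a) (q a))) ,
         from (Sat-farPairs k) far ,
         from (Sat-andFin H k g) (λ a → proj₂ (from (body ρ a) (q a)))) ⇔∘ Spread-tabulate

    Sat-universal : ∀ k (pre : Formula w (suc k)) (g : Fin (suc k) → Formula w (suc k))
      {C M ψ : Fin (n H) → Set} →
      (∀ ρ → ((∀ a → ρ a ∈ˢ dom H) × Sat H pre ρ) ⇔
             ((∀ a b → a F.< b → Far H d (ρ a) (ρ b)) × (∀ a → M (ρ a)))) →
      (∀ ρ a → Sat H (g a) ρ ⇔ ψ (ρ a)) →
      H ⊨ allN (suc k) (pre ⇒ orFin (suc k) g) ⇔ Meaning universal k (Far H d) C M ψ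
    Sat-universal k pre g {C} {M} {ψ} guard body = Sat-allN H (suc k) _ ⇔∘ mk⇔
      (λ h ρ c → let ∈dom , p = from (guard ρ) c
                     a , s = to (Sat-orFin H (suc k) g) (to (Sat-⇒ H pre _) (h ρ ∈dom) p)
                 in a , to (body ρ a) s)
      (λ h ρ ∈dom → from (Sat-⇒ H pre _) λ p →
         let a , s = h ρ (to (guard ρ) (∈dom , p))
         in from (Sat-orFin H (suc k) g) (a , from (body ρ a) s))
      ⇔∘ Meaning-universal-tabulate {C = C}

  Sat-basicSentence : ∀ {u} (H : Interp (suc u)) (β : Basic u) →
    H ⊨ basicSentence β ⇔
    Meaning (kind β) (spread β) (Far H (2 ℕ.* range β)) (_∈ˢ dom H) (_∈ˢ dom H) (Holds H (core β))
  Sat-basicSentence H β with kind β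
  ... | existential = Sat-existential H (2 ℕ.* range β) (spread β) _
          λ ρ a → Eqv.refl ×-⇔ Sat-apply H (core β) a
  ... | universal = Sat-universal H (2 ℕ.* range β) (spread β) _ _ {C = _∈ˢ dom H}
          (λ ρ → mk⇔ (λ (∈dom , s) → to (Sat-farPairs H _ _) s , ∈dom)
                     (λ (far , ∈dom) → ∈dom , from (Sat-farPairs H _ _) far))
          (λ ρ a → Sat-apply H (core β) a)

  Sat-variant : ∀ {u} (K : Interp (suc (suc (suc u)))) (β : Basic u) (q : ℕ) {C M : Fin (n K) → Set} →
    (∀ x → (x ∈ˢ dom K × x ∈ˢ P K symC) ⇔ C x) → (∀ x → (x ∈ˢ dom K × x ∈ˢ P K symM) ⇔ M x) →
    K ⊨ variant β q ⇔
    Meaning (kind β) q (Far K (2 ℕ.* range β)) C M (Holds (reduct embedXL K) (core β))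
  Sat-variant K β q {C} C⇔ M⇔ with kind β
  ... | existential = Sat-existential K (2 ℕ.* range β) q _
          λ ρ a → mk⇔
            (λ (d , c , s) → to (C⇔ (ρ a)) (d , c) , to (sat-core ρ a) s)
            (λ (dc , s) → let d , c = from (C⇔ (ρ a)) dc in d , c , from (sat-core ρ a) s)
    where
    sat-core : ∀ {v} (ρ : Fin v → Fin (n K)) a →
      Sat K (mapSym embedXL (apply (core β) a)) ρ ⇔ Holds (reduct embedXL K) (core β) (ρ a)
    sat-core ρ a = Sat-mapSym K embedXL (apply (core β) a) ⇔∘ Sat-apply _ (core β) a
  ... | universal = Sat-universal K (2 ℕ.* range β) q _ _ {C = C}
          (λ ρ → mk⇔
            (λ (∈dom , ms , far) → to (Sat-farPairs K _ _) far ,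
               λ a → to (M⇔ (ρ a)) (∈dom a , to (Sat-andFin K _ (pred symM)) ms a))
            (λ (far , m) → (λ a → proj₁ (from (M⇔ (ρ a)) (m a))) ,
               from (Sat-andFin K _ (pred symM)) (λ a → proj₂ (from (M⇔ (ρ a)) (m a))) ,
               from (Sat-farPairs K _ _) far))
          (λ ρ a → Sat-mapSym K embedXL (apply (core β) a) ⇔∘ Sat-apply _ (core β) a)

  -- Polarity of X and transfer of local formulas between interpretations.

  Occ-rename : ∀ {u v v'} b (σ : Fin v → Fin v') (φ : Formula (suc u) v) →
    Occ b (rename σ φ) → Occ b φ
  Occ-rename b σ tt o = o
  Occ-rename b σ ff o = o
  Occ-rename b σ (eq x y) o = o
  Occ-rename b σ (adj x y) o = o
  Occ-rename b σ (pred zero x) o = o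
  Occ-rename b σ (pred (suc s) x) o = o
  Occ-rename b σ (neg φ) o = Occ-rename (not b) σ φ o
  Occ-rename b σ (and φ ψ) (o , o') = Occ-rename b σ φ o , Occ-rename b σ ψ o'
  Occ-rename b σ (or φ ψ) (o , o') = Occ-rename b σ φ o , Occ-rename b σ ψ o'
  Occ-rename b σ (ex φ) o = Occ-rename b (lift σ) φ o
  Occ-rename b σ (all φ) o = Occ-rename b (lift σ) φ o

  Occ-exN : ∀ {u} b k (φ : Formula (suc u) k) → Occ b (exN k φ) → Occ b φ
  Occ-exN b zero φ o = o
  Occ-exN b (suc k) φ o = Occ-exN b k (ex φ) o

  Occ-allN : ∀ {u} b k (φ : Formula (suc u) k) → Occ b (allN k φ) → Occ b φ
  Occ-allN b zero φ o = o
  Occ-allN b (suc k) φ o = Occ-allN b k (all φ) o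

  Occ-andFin : ∀ {u v} b k (f : Fin k → Formula (suc u) v) →
    Occ b (andFin k f) → ∀ i → Occ b (f i)
  Occ-andFin b (suc k) f (o , _) zero = o
  Occ-andFin b (suc k) f (_ , o) (suc i) = Occ-andFin b k (f ∘ suc) o i

  -- The core does not occur in an existential sentence of spread 0, so
  -- positivity of the sentence says nothing about it; there the core is replaced.
  core⁺ : ∀ {w r} → Kind → ℕ → Local w r 0 → Local w r 0
  core⁺ existential zero ψ = ltt
  core⁺ existential (suc m) ψ = ψ
  core⁺ universal m ψ = ψ

  -- For an existential term with m = 0 the bound forces q = 0, and the empty list is a witness for
  -- either core; in all other cases the two cores coincide.
  Meaning-core⁺ : ∀ {w r} {H : Interp w} {R} {C M : Fin (n H) → Set} κ {m q} (ψ : Local w r 0) →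
    q ≤ m → Meaning κ q R C M (Holds H ψ) ⇔ Meaning κ q R C M (Holds H (core⁺ κ m ψ))
  Meaning-core⁺ existential {zero} ψ z≤n = mk⇔
    (λ { ([] , refl , [] , []) → [] , refl , [] , [] })
    (λ { ([] , refl , [] , []) → [] , refl , [] , [] })
  Meaning-core⁺ existential {suc m} ψ _ = Eqv.refl
  Meaning-core⁺ universal ψ _ = Eqv.refl

  Occ-core⁺ : ∀ {u} (β : Basic u) → Occ true (basicSentence β) →
    Occ true (toF (core⁺ (kind β) (spread β) (core β)))
  Occ-core⁺ β o with kind β
  ... | universal = Occ-rename true _ (toF (core β))
          (proj₁ (proj₂ (Occ-allN true (suc (spread β)) _ o)))
  ... | existential with spread β
  ...   | zero = tt
  ...   | suc m = Occ-rename true _ (toF (core β))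
          (proj₁ (proj₂ (Occ-exN true (suc m) _ o)))

  -- Each negation reverses the direction in which satisfaction is preserved. Indexing the
  -- implication by the polarity lets a single induction on formulas cover both directions.
  Dir : Bool → Set → Set → Set
  Dir true A B = A → B
  Dir false A B = B → A

  Dir-cong : ∀ b {A A' B B'} → A ⇔ A' → B ⇔ B' → Dir b A' B' → Dir b A B
  Dir-cong true e f g = from f ∘ g ∘ to e
  Dir-cong false e f g = from e ∘ g ∘ to f

  ⇔⇒Dir : ∀ b {A B} → A ⇔ B → Dir b A B
  ⇔⇒Dir true e = to e
  ⇔⇒Dir false e = from e

  Dir-¬ : ∀ b {A B} → Dir (not b) A B → Dir b (¬ A) (¬ B)
  Dir-¬ true f = _∘ f
  Dir-¬ false f = _∘ f

  Dir-× : ∀ b {A A' B B'} → Dir b A B → Dir b A' B' → Dir b (A × A') (B × B')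
  Dir-× true f g (a , a') = f a , g a'
  Dir-× false f g (a , a') = f a , g a'

  Dir-⊎ : ∀ b {A A' B B'} → Dir b A B → Dir b A' B' → Dir b (A ⊎ A') (B ⊎ B')
  Dir-⊎ true f g = Sum.map f g
  Dir-⊎ false f g = Sum.map f g

  Dir-Σ : ∀ b {V : Set} {D D' A B : V → Set} → (∀ a → D a ⇔ D' a) →
    (∀ a → D a → Dir b (A a) (B a)) →
    Dir b (Σ V λ a → D a × A a) (Σ V λ a → D' a × B a)
  Dir-Σ true e f (a , d , s) = a , to (e a) d , f a d s
  Dir-Σ false e f (a , d , s) = a , from (e a) d , f a (from (e a) d) s

  Dir-Π : ∀ b {V : Set} {D D' A B : V → Set} → (∀ a → D a ⇔ D' a) →
    (∀ a → D a → Dir b (A a) (B a)) →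
    Dir b (∀ a → D a → A a) (∀ a → D' a → B a)
  Dir-Π true e f h a d = f a (from (e a) d) (h a (from (e a) d))
  Dir-Π false e f h a d = f a d (h a (to (e a) d))

  Ball : ∀ {w} (H : Interp w) → ℕ → Fin (n H) → Fin (n H) → Set
  Ball H r x y = y ∈ˢ dom H × Dist H r x y

  module _ {w r v : ℕ} (H : Interp w) (φ : Local w r (suc v)) (ρ : Fin (suc v) → Fin (n H)) where

    private
      c = fromℕ (suc v)

    Sat-lex : Sat H (toF (lex φ)) ρ ⇔
      (Σ (Fin (n H)) λ a → Ball H r (ρ (fromℕ v)) a × Sat H (toF φ) (ext ρ a))
    Sat-lex = mk⇔
      (λ (a , a∈ , d , s) → a , (a∈ , to (Sat-distLe H r c zero) d) , s)
      (λ (a , (a∈ , d) , s) → a , a∈ , from (Sat-distLe H r c zero) d , s)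

    Sat-lall : Sat H (toF (lall φ)) ρ ⇔
      (∀ a → Ball H r (ρ (fromℕ v)) a → Sat H (toF φ) (ext ρ a))
    Sat-lall = mk⇔
      (λ h a (a∈ , d) → to (Sat-⇒ H (distLe r c zero) (toF φ)) (h a a∈)
         (from (Sat-distLe H r c zero) d))
      (λ h a a∈ → from (Sat-⇒ H (distLe r c zero) (toF φ))
         (λ d → h a (a∈ , to (Sat-distLe H r c zero) d)))

  module _ {u N : ℕ} {D₁ D₂ : Subset N} {adj : Fin N → Fin N → Bool}
           {P₁ P₂ : Fin (suc u) → Subset N} where

    private
      H₁ H₂ : Interp (suc u)
      H₁ = record { n = N ; dom = D₁ ; E = adj ; P = P₁ }
      H₂ = record { n = N ; dom = D₂ ; E = adj ; P = P₂ }

    module _ {r : ℕ} {x : Fin N}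
             (ball : ∀ y → Ball H₁ r x y ⇔ Ball H₂ r x y)
             (X : ∀ y → Ball H₁ r x y → y ∈ˢ P₁ zero → y ∈ˢ P₂ zero)
             (L : ∀ s y → Ball H₁ r x y → y ∈ˢ P₁ (suc s) ⇔ y ∈ˢ P₂ (suc s)) where

      -- Every quantifier of an r-local formula ranges over the r-ball around `x`, so all variables
      -- stay in that ball and the two interpretations have to agree only there: on L exactly, on X
      -- by inclusion.
      Sat-transfer : ∀ {v} b (ψ : Local (suc u) r v) {ρ : Fin (suc v) → Fin N} →
        Occ b (toF ψ) → ρ (fromℕ v) ≡ x → (∀ i → Ball H₁ r x (ρ i)) →
        Dir b (Sat H₁ (toF ψ) ρ) (Sat H₂ (toF ψ) ρ)
      Sat-transfer b ltt o e near = ⇔⇒Dir b Eqv.refl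
      Sat-transfer b lff o e near = ⇔⇒Dir b Eqv.refl
      Sat-transfer b (leq i j) o e near = ⇔⇒Dir b Eqv.refl
      Sat-transfer b (ladj i j) o e near = ⇔⇒Dir b Eqv.refl
      -- `Occ` forces positive polarity at an occurrence of X, so the one inclusion `X` is enough.
      Sat-transfer .true (lpred zero i) refl e near = X _ (near i)
      Sat-transfer b (lpred (suc s) i) o e near = ⇔⇒Dir b (L s _ (near i))
      Sat-transfer b (lneg ψ) o e near = Dir-¬ b (Sat-transfer (not b) ψ o e near)
      Sat-transfer b (land ψ χ) (o , o') e near =
        Dir-× b (Sat-transfer b ψ o e near) (Sat-transfer b χ o' e near)
      Sat-transfer b (lor ψ χ) (o , o') e near =
        Dir-⊎ b (Sat-transfer b ψ o e near) (Sat-transfer b χ o' e near)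
      Sat-transfer b (lex ψ) {ρ} (_ , o) refl near =
        Dir-cong b (Sat-lex H₁ ψ ρ) (Sat-lex H₂ ψ ρ)
          (Dir-Σ b ball λ a near-a →
             Sat-transfer b ψ o refl λ { zero → near-a ; (suc i) → near i })
      Sat-transfer b (lall ψ) {ρ} (_ , o) refl near =
        Dir-cong b (Sat-lall H₁ ψ ρ) (Sat-lall H₂ ψ ρ)
          (Dir-Π b ball λ a near-a →
             Sat-transfer b ψ o refl λ { zero → near-a ; (suc i) → near i })

      Holds-transfer : (ψ : Local (suc u) r 0) → Occ true (toF ψ) → x ∈ˢ D₁ →
        Holds H₁ ψ x → Holds H₂ ψ x
      Holds-transfer ψ o x∈ = Sat-transfer true ψ o refl λ _ → x∈ , Dist-refl H₁ r x∈

open Semantics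

-- Finite sums, far-apart systems and plans, abstracted from the graph.

module Plans where

  open import Data.Nat using (_+_; _*_; _∸_; _≤_; _<_)

  χ : ∀ {A : Set} → Dec A → ℕ
  χ (yes _) = 1
  χ (no _) = 0

  χ-yes : ∀ {A : Set} (d : Dec A) → A → χ d ≡ 1
  χ-yes (yes _) a = refl
  χ-yes (no ¬a) a = contradiction a ¬a

  χ-no : ∀ {A : Set} (d : Dec A) → ¬ A → χ d ≡ 0
  χ-no (yes a) ¬a = contradiction a ¬a
  χ-no (no _) ¬a = refl

  ∑ : ∀ {A : Set} → List A → (A → ℕ) → ℕ
  ∑ xs f = sum (map f xs)

  module _ {A : Set} where

    ∑-mono : ∀ (xs : List A) {f g : A → ℕ} → (∀ {x} → x ∈ xs → f x ≤ g x) → ∑ xs f ≤ ∑ xs g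
    ∑-mono [] h = z≤n
    ∑-mono (x ∷ xs) h = ℕP.+-mono-≤ (h (here refl)) (∑-mono xs (h ∘ there))

    ∑-cong : ∀ (xs : List A) {f g : A → ℕ} → (∀ {x} → x ∈ xs → f x ≡ g x) → ∑ xs f ≡ ∑ xs g
    ∑-cong [] h = refl
    ∑-cong (x ∷ xs) h = cong₂ _+_ (h (here refl)) (∑-cong xs (h ∘ there))

    ∑-+ : ∀ (xs : List A) (f g : A → ℕ) → ∑ xs (λ x → f x + g x) ≡ ∑ xs f + ∑ xs g
    ∑-+ [] f g = refl
    ∑-+ (x ∷ xs) f g rewrite ∑-+ xs f g = shuffle (f x) (g x) (∑ xs f) (∑ xs g)
      where
      shuffle : ∀ a b c d → (a + b) + (c + d) ≡ (a + c) + (b + d)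
      shuffle = ℕSolver.solve-∀

    ∑-*ˡ : ∀ (xs : List A) c (f : A → ℕ) → ∑ xs (λ x → c * f x) ≡ c * ∑ xs f
    ∑-*ˡ [] c f = sym (ℕP.*-zeroʳ c)
    ∑-*ˡ (x ∷ xs) c f rewrite ∑-*ˡ xs c f = sym (ℕP.*-distribˡ-+ c (f x) _)

    ∑-const : ∀ (xs : List A) c → ∑ xs (λ _ → c) ≡ length xs * c
    ∑-const [] c = refl
    ∑-const (x ∷ xs) c = cong (_+_ c) (∑-const xs c)

    ∑-length : ∀ (xs : List A) → ∑ xs (λ _ → 1) ≡ length xs
    ∑-length xs = trans (∑-const xs 1) (ℕP.*-identityʳ _)

    ∑-∈ : ∀ {xs : List A} (f : A → ℕ) {x} → x ∈ xs → f x ≤ ∑ xs f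
    ∑-∈ f (here refl) = ℕP.m≤m+n _ _
    ∑-∈ f (there x∈) = ℕP.≤-trans (∑-∈ f x∈) (ℕP.m≤n+m _ _)

    ∑-average : ∀ (xs : List A) (f : A → ℕ) → 0 < length xs →
      Σ A λ x → x ∈ xs × length xs * f x ≤ ∑ xs f
    ∑-average (x ∷ []) f _ = x , here refl , ℕP.≤-refl
    ∑-average (x ∷ xs@(_ ∷ _)) f _ with ∑-average xs f (s≤s z≤n)
    ... | y , y∈ , le with ℕP.≤-total (f x) (f y)
    ...   | inj₁ x≤y = x , here refl ,
            ℕP.+-monoʳ-≤ (f x) (ℕP.≤-trans (ℕP.*-monoʳ-≤ (length xs) x≤y) le)
    ...   | inj₂ y≤x = y , there y∈ , ℕP.+-mono-≤ y≤x le

    module _ {P : A → Set} (P? : Decidable P) where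

      ∑-χ≤1 : ∀ {xs} → Unique xs → (∀ {x y} → P x → P y → x ≡ y) → ∑ xs (χ ∘ P?) ≤ 1
      ∑-χ≤1 [] uniq = z≤n
      ∑-χ≤1 {x ∷ xs} (x∉ ∷ u) uniq with P? x
      ... | no _ = ∑-χ≤1 u uniq
      ... | yes px = s≤s (ℕP.≤-reflexive (trans
              (∑-cong xs λ {y} y∈ → χ-no (P? y) λ py → All.lookup x∉ y∈ (uniq px py))
              (trans (∑-const xs 0) (ℕP.*-zeroʳ (length xs)))))

      1≤∑-χ : ∀ {xs x} → x ∈ xs → P x → 1 ≤ ∑ xs (χ ∘ P?)
      1≤∑-χ {x = x} x∈ px =
        ℕP.≤-trans (ℕP.≤-reflexive (sym (χ-yes (P? x) px))) (∑-∈ (χ ∘ P?) x∈)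

      ∑-χ-length : ∀ xs → ∑ xs (χ ∘ P?) ≡ length (filter P? xs)
      ∑-χ-length [] = refl
      ∑-χ-length (x ∷ xs) with P? x
      ... | yes _ = cong suc (∑-χ-length xs)
      ... | no _ = ∑-χ-length xs

  ∑-swap : ∀ {A B : Set} (xs : List A) (ys : List B) (f : A → B → ℕ) →
    ∑ xs (λ x → ∑ ys (f x)) ≡ ∑ ys (λ y → ∑ xs (λ x → f x y))
  ∑-swap [] ys f = sym (trans (∑-const ys 0) (ℕP.*-zeroʳ (length ys)))
  ∑-swap (x ∷ xs) ys f =
    trans (cong (_+_ (∑ ys (f x))) (∑-swap xs ys f)) (sym (∑-+ ys (f x) _))

  length-concat-map : ∀ {A B : Set} (f : A → List B) xs →
    length (concat (map f xs)) ≡ ∑ xs (λ x → length (f x))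
  length-concat-map f [] = refl
  length-concat-map f (x ∷ xs) =
    trans (ListP.length-++ (f x)) (cong (_+_ (length (f x))) (length-concat-map f xs))

  window-unique : ∀ B → Unique (window B)
  window-unique B =
    UniqueP.map⁺ (λ eq → ℤP.+-injective (∙-cancelʳ ℤP.+-0-abelianGroup (ℤ.- + B) _ _ eq)) (UniqueP.upTo⁺ _)

  ∈-window : ∀ {B} k → ℤ.∣ k ∣ ≤ B → k ∈ window B
  ∈-window {B} k k≤B = subst (_∈ window B) (sym (proj₁ (proj₂ (index k k≤B))))
    (∈-map⁺ _ (∈-upTo⁺ (s≤s (proj₂ (proj₂ (index k k≤B))))))
    where
    index : ∀ k → ℤ.∣ k ∣ ≤ B → Σ ℕ λ j → k ≡ + j ℤ.- + B × j ≤ 2 * B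
    index (+ a) a≤B = a + B , shift (+ a) (+ B) ,
      ℕP.≤-trans (ℕP.+-monoˡ-≤ B a≤B) (ℕP.+-monoʳ-≤ B (ℕP.m≤m+n B 0))
      where
      shift : ∀ a b → a ≡ (a ℤ.+ b) ℤ.- b
      shift = ℤSolver.solve-∀
    index -[1+ a ] a≤B with ℕP.m≤n⇒∃[o]m+o≡n a≤B
    ... | e , refl = e , shift (+ suc a) (+ e) ,
          ℕP.≤-trans (ℕP.m≤n+m e (suc a)) (ℕP.m≤m+n _ _)
      where
      shift : ∀ a b → ℤ.- a ≡ b ℤ.- (a ℤ.+ b)
      shift = ℤSolver.solve-∀

  Any-map-All : ∀ {V : Set} {M P Q : V → Set} {xs} →
    (∀ {x} → M x → P x → Q x) → All M xs → Any P xs → Any Q xs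
  Any-map-All f (mx ∷ _) (here px) = here (f mx px)
  Any-map-All f (_ ∷ m) (there a) = there (Any-map-All f m a)

  Spread-map : ∀ {V : Set} {R R' : V → V → Set} {Q Q' : V → Set} {k} →
    (∀ {x y} → Q x → Q y → R x y → R' x y) → (∀ {x} → Q x → Q' x) →
    Spread R Q k → Spread R' Q' k
  Spread-map {R = R} {R'} {Q} f g (xs , l , far , q) = xs , l , go far q , All.map g q
    where
    go : ∀ {xs} → AllPairs R xs → All Q xs → AllPairs R' xs
    go [] [] = []
    go (x~ ∷ far) (qx ∷ q) = All.zipWith (λ (r , qy) → f qx qy r) (x~ , q) ∷ go far q

  module _ {V : Set} {R : V → V → Set} {Q : V → Set} where

    Spread-≤ : ∀ {j k} → j ≤ k → Spread R Q k → Spread R Q j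
    Spread-≤ {j} j≤k (xs , refl , far , q) = take j xs ,
      trans (ListP.length-take j xs) (ℕP.m≤n⇒m⊓n≡m j≤k) ,
      AllPairsP.take⁺ j far , AllP.take⁺ j q

    -- Used twice: to join the witnesses of an existential term, and to join local violators of a
    -- universal core, whose total is thereby bounded by the spread.
    Spread-concat : ∀ {I : Set} {Rᵢ : I → V → V → Set} {Qᵢ : I → V → Set} {p : I → ℕ} {is : List I} →
      Unique is → (∀ i → Spread (Rᵢ i) (Qᵢ i) (p i)) →
      (∀ {i x y} → Qᵢ i x → Qᵢ i y → Rᵢ i x y → R x y) →
      (∀ {i j x y} → i ≢ j → Qᵢ i x → Qᵢ j y → R x y) →
      (∀ {i x} → Qᵢ i x → Q x) → Spread R Q (∑ is p)
    Spread-concat {I} {Rᵢ} {Qᵢ} {p} {is} u spread inside across q =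
      concat (map xs is) ,
      trans (length-concat-map xs is) (∑-cong is λ {i} _ → proj₁ (proj₂ (part i))) ,
      AllPairsP.concat⁺ (AllP.map⁺ (All.universal (λ i → proj₁ (proj₂ (proj₂ (part i)))) is))
        (AllPairsP.map⁺ (AllPairs.map (λ i≢j → All.map (λ qx → All.map (across i≢j qx) (qs _)) (qs _)) u)) ,
      AllP.concat⁺ (AllP.map⁺ (All.universal (λ i → All.map q (qs i)) is))
      where
      part : ∀ i → Spread R (Qᵢ i) (p i)
      part i = Spread-map inside id (spread i)
      xs : I → List V
      xs i = proj₁ (part i)
      qs : ∀ i → All (Qᵢ i) (xs i)
      qs i = proj₂ (proj₂ (proj₂ (part i)))

  module _ {N : ℕ} {R : Fin N → Fin N → Set} (R? : ∀ x y → Dec (R x y)) where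

    Spread? : ∀ {Q : Fin N → Set} → Decidable Q → ∀ k → Dec (Spread R Q k)
    Spread? Q? zero = yes ([] , refl , [] , [])
    Spread? Q? (suc k) = map′
      (λ (x , qx , xs , l , far , qs) → x ∷ xs , cong suc l ,
         All.map proj₂ qs ∷ far , qx ∷ All.map proj₁ qs)
      (λ { (x ∷ xs , l , x~ ∷ far , qx ∷ qs) →
         x , qx , xs , ℕP.suc-injective l , far , All.zip (qs , x~) })
      (FP.any? λ x → Q? x ×-dec Spread? (λ y → Q? y ×-dec R? x y) k)

    -- Counting down from m with `Spread?`. The system found has maximum length, so it is also
    -- maximal under adding a vertex.
    Spread-max : ∀ {Q : Fin N → Set} → Decidable Q → ∀ m → ¬ Spread R Q (suc m) →
      Σ ℕ λ j → j ≤ m × Spread R Q j × ¬ Spread R Q (suc j)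
    Spread-max Q? m ¬s with Spread? Q? m
    ... | yes s = m , ℕP.≤-refl , s , ¬s
    Spread-max Q? zero ¬s | no ¬s' = contradiction ([] , refl , [] , []) ¬s'
    Spread-max Q? (suc m) ¬s | no ¬s' with Spread-max Q? m ¬s'
    ...   | j , j≤m , s , max = j , ℕP.m≤n⇒m≤1+n j≤m , s , max

  module _ {V : Set} {R : V → V → Set} {C M ψ : V → Set} where

    -- Together with its converse below this reads a universal sentence as a bound on far-apart
    -- systems of violators of the core, the form in which plans are computed.
    Meaning-universal⇒¬Spread : ∀ {k} → Meaning universal k R C M ψ →
      ¬ Spread R (λ x → M x × ¬ ψ x) (suc k)
    Meaning-universal⇒¬Spread h (xs , l , far , q) =
      AllP.All¬⇒¬Any (All.map proj₂ q) (h xs l far (All.map proj₁ q))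

    ¬Spread⇒Meaning-universal : Decidable ψ → ∀ {k} →
      ¬ Spread R (λ x → M x × ¬ ψ x) (suc k) → Meaning universal k R C M ψ
    ¬Spread⇒Meaning-universal ψ? ¬s xs l far m with Any.any? ψ? xs
    ... | yes a = a
    ... | no ¬a = contradiction (xs , l , far , All.zip (m , AllP.¬Any⇒All¬ xs ¬a)) ¬s

  Meaning-map : ∀ {V : Set} {R R' : V → V → Set} {C M ψ ψ' : V → Set} κ {k} →
    (∀ {x y} → R x y → R' x y) → (∀ {x y} → R' x y → R x y) →
    (∀ {x} → C x → ψ x → ψ' x) → (∀ {x} → M x → ψ x → ψ' x) →
    Meaning κ k R C M ψ → Meaning κ k R' C M ψ'
  Meaning-map existential R⇒ R⇐ f g = Spread-map (λ _ _ → R⇒) (λ (c , s) → c , f c s)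
  Meaning-map universal R⇒ R⇐ f g h xs l far m = Any-map-All g m (h xs l (AllPairs.map R⇐ far) m)

  module _ {V : Set} (kOf : V → ℤ) where

    fibre : List V → ℤ → List V
    fibre xs k = filter (λ x → kOf x ℤP.≟ k) xs

    fibre-total : ∀ xs ks →
      ∑ ks (λ k → length (fibre xs k)) ≡ ∑ xs (λ x → ∑ ks (λ k → χ (kOf x ℤP.≟ k)))
    fibre-total xs ks = trans
      (∑-cong ks λ {k} _ → sym (∑-χ-length (λ x → kOf x ℤP.≟ k) xs))
      (∑-swap ks xs (λ k x → χ (kOf x ℤP.≟ k)))

    fibre-total-unique : ∀ xs {ks} → Unique ks → (∀ x → kOf x ∈ ks) →
      ∑ ks (λ k → length (fibre xs k)) ≡ length xs
    fibre-total-unique xs {ks} u in-ks = trans (fibre-total xs ks)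
      (trans (∑-cong xs λ {x} _ → ℕP.≤-antisym
               (∑-χ≤1 (λ k → kOf x ℤP.≟ k) u λ e e' → trans (sym e) e')
               (1≤∑-χ (λ k → kOf x ℤP.≟ k) (in-ks x) refl))
             (∑-length xs))

    pigeonhole : ∀ (p : ℤ → ℕ) xs ks → (∀ {x} → x ∈ xs → kOf x ∈ ks) →
      ∑ ks p < length xs → Σ ℤ λ k → p k < length (fibre xs k)
    pigeonhole p xs ks in-ks lt with Any.any? (λ k → p k ℕP.<? length (fibre xs k)) ks
    ... | yes a = let k , _ , lt = find a in k , lt
    ... | no none = contradiction lt (ℕP.≤⇒≯ (begin
        length xs                                        ≡⟨ ∑-length xs ⟨
        ∑ xs (λ _ → 1)                                   ≤⟨ ∑-mono xs (λ {x} x∈ →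
                                                              1≤∑-χ (λ k → kOf x ℤP.≟ k) (in-ks x∈) refl) ⟩
        ∑ xs (λ x → ∑ ks (λ k → χ (kOf x ℤP.≟ k)))       ≡⟨ fibre-total xs ks ⟨
        ∑ ks (λ k → length (fibre xs k))                 ≤⟨ ∑-mono ks (λ k∈ →
                                                              ℕP.≮⇒≥ (All.lookup (AllP.¬Any⇒All¬ ks none) k∈)) ⟩
        ∑ ks p ∎))
      where open ℕP.≤-Reasoning

  -- A point outside the plan's support window settles the claim by itself.
  pigeonhole-plan : ∀ {V : Set} (kOf : V → ℤ) {m p} → IsPlan m p → ∀ xs → length xs ≡ suc m →
    Σ ℤ λ k → p k < length (fibre kOf xs k)
  pigeonhole-plan kOf {m} {p} (B , supp , total) xs l
    with All.all? (λ x → ℤ.∣ kOf x ∣ ℕP.≤? B) xs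
  ... | yes inside = pigeonhole kOf p xs (window B)
          (λ {x} x∈ → ∈-window (kOf x) (All.lookup inside x∈))
          (subst₂ _<_ (sym total) (sym l) ℕP.≤-refl)
  ... | no ¬inside with find (AllP.¬All⇒Any¬ (λ x → ℤ.∣ kOf x ∣ ℕP.≤? B) xs ¬inside)
  ...   | x , x∈ , ∣k∣≰B = kOf x , subst (_< _) (sym (supp (kOf x) (ℕP.≰⇒> ∣k∣≰B)))
            (subst (0 <_) (∑-χ-length (λ y → kOf y ℤP.≟ kOf x) xs)
              (1≤∑-χ (λ y → kOf y ℤP.≟ kOf x) x∈ refl))

  plan-≤ : ∀ {m p} → IsPlan m p → ∀ k → p k ≤ m
  plan-≤ {m} {p} (B , supp , total) k with ℤ.∣ k ∣ ℕP.≤? B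
  ... | yes k≤B = subst (p k ≤_) total (∑-∈ p (∈-window k k≤B))
  ... | no k≰B = subst (_≤ m) (sym (supp k (ℕP.≰⇒> k≰B))) z≤n

  module _ {V : Set} {R : V → V → Set} {Rᵢ : ℤ → V → V → Set} {C M : ℤ → V → Set}
           (inside : ∀ {k x y} → C k x → C k y → Rᵢ k x y → R x y)
           (across : ∀ {k k' x y} → k ≢ k' → C k x → C k' y → R x y)
           (local : ∀ {k x y} → R x y → Rᵢ k x y)
           where

    -- Existential witnesses have to remain far apart globally, which `inside` and `across` give on
    -- `C`. A universal term needs only the converse direction `local`, so it can be read on `M`,
    -- and `M-kOf` puts every vertex into some `M k`.
    Meaning-glue : ∀ κ {m p} {Cᵍ Mᵍ ψ : V → Set} {ψᵢ : ℤ → V → Set} (kOf : V → ℤ) →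
      (∀ {k x} → C k x → Cᵍ x) → (∀ {x} → Mᵍ x → M (kOf x) x) →
      (∀ {k x} → C k x → ψᵢ k x → ψ x) → (∀ {k x} → M k x → ψᵢ k x → ψ x) →
      IsPlan m p → (∀ k → Meaning κ (p k) (Rᵢ k) (C k) (M k) (ψᵢ k)) → Meaning κ m R Cᵍ Mᵍ ψ
    Meaning-glue existential kOf C⊆ M-kOf fC fM (B , _ , refl) h =
      Spread-concat (window-unique B) h
        (λ (c , _) (c' , _) → inside c c') (λ k≢ (c , _) (c' , _) → across k≢ c c')
        (λ (c , s) → C⊆ c , fC c s)
    Meaning-glue universal {p = p} {Mᵍ = Mᵍ} {ψ} kOf C⊆ M-kOf fC fM plan h xs l far m
      with pigeonhole-plan kOf plan xs l
    ... | k , lt = AnyP.filter⁻ (λ x → kOf x ℤP.≟ k) (untake (Any-map-All fM here-M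
            (h k ys (trans (ListP.length-take (suc (p k)) (fibre kOf xs k)) (ℕP.m≤n⇒m⊓n≡m lt))
               (AllPairs.map local (AllPairsP.take⁺ (suc (p k))
                  (AllPairsP.filter⁺ (λ x → kOf x ℤP.≟ k) far)))
               here-M)))
      where
      -- The overfull fibre may be longer than p k + 1, while the local sentence speaks of lists of
      -- exactly that length.
      ys = take (suc (p k)) (fibre kOf xs k)
      here-M : All (M k) ys
      here-M = All.zipWith (λ { (mx , refl) → M-kOf mx })
        (AllP.take⁺ (suc (p k)) (AllP.filter⁺ (λ x → kOf x ℤP.≟ k) m) ,
         AllP.take⁺ (suc (p k)) (AllP.all-filter (λ x → kOf x ℤP.≟ k) xs))
      untake : Any ψ ys → Any ψ (fibre kOf xs k)
      untake a = subst (Any ψ) (ListP.take++drop≡id (suc (p k)) _) (AnyP.++⁺ˡ a)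

    -- Each witness is counted for the interval `kOf x` alone, so the fibre lengths add up to the
    -- number of witnesses even though intervals overlap.
    existential-plan : ∀ {B} {ψ : V → Set} {ψᵢ : ℤ → V → Set} (kOf : V → ℤ) →
      (∀ x → ℤ.∣ kOf x ∣ ≤ B) → (∀ {k x} → C k x → ψ x → ψᵢ k x) →
      ∀ xs → AllPairs R xs → All (λ x → C (kOf x) x) xs → All ψ xs →
      Σ (ℤ → ℕ) λ p → ((∀ k → B < ℤ.∣ k ∣ → p k ≡ 0) × sumZ B p ≡ length xs) ×
        ∀ k → Spread (Rᵢ k) (λ x → C k x × ψᵢ k x) (p k)
    existential-plan {B} kOf kOf≤B f xs far c s =
      (λ k → length (fibre kOf xs k)) ,
      ((λ k B<k → trans (sym (∑-χ-length (λ x → kOf x ℤP.≟ k) xs))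
         (trans (∑-cong xs λ {x} _ → χ-no (kOf x ℤP.≟ k)
                   λ { refl → ℕP.<⇒≱ B<k (kOf≤B x) })
                (trans (∑-const xs 0) (ℕP.*-zeroʳ (length xs))))) ,
       fibre-total-unique kOf xs (window-unique B) (λ x → ∈-window (kOf x) (kOf≤B x))) ,
      λ k → fibre kOf xs k , refl ,
        AllPairs.map local (AllPairsP.filter⁺ (λ x → kOf x ℤP.≟ k) far) ,
        All.zipWith (λ { (refl , c , s) → c , f c s })
          (AllP.all-filter (λ x → kOf x ℤP.≟ k) xs ,
           AllP.filter⁺ (λ x → kOf x ℤP.≟ k) (All.zip (c , s)))

    -- In each interval the maximum number of far-apart local violators is the least value for which
    -- the local universal sentence holds. By `good` these violators lie in `C` and violate the core
    -- globally, so the maxima join to one system that the global sentence limits to m.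
    universal-plan : ∀ {B m} {Cᵍ Mᵍ ψ : V → Set} {ψᵢ : ℤ → V → Set} →
      (spreads : ∀ k → Σ ℕ λ j → Spread (Rᵢ k) (λ x → M k x × ¬ ψᵢ k x) j ×
                                 ¬ Spread (Rᵢ k) (λ x → M k x × ¬ ψᵢ k x) (suc j)) →
      (∀ k → Decidable (ψᵢ k)) →
      (∀ {k x} → M k x → Mᵍ x) → (∀ {k x} → M k x → ℤ.∣ k ∣ ≤ B) →
      (∀ {k x} → M k x → ¬ ψᵢ k x → C k x × ¬ ψ x) →
      Meaning universal m R Cᵍ Mᵍ ψ →
      Σ (ℤ → ℕ) λ p → ((∀ k → B < ℤ.∣ k ∣ → p k ≡ 0) × sumZ B p ≡ m) ×
        ∀ k → Meaning universal (p k) (Rᵢ k) (C k) (M k) (ψᵢ k)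
    universal-plan {B} {m} {Cᵍ} {Mᵍ} {ψ} {ψᵢ} spreads ψᵢ? M⊆ M≤B good h =
      p , ((λ k B<k → cong₂ _+_ (size-0 k B<k)
              (trans (cong ((m ∸ used) *_) (χ-no (k ℤP.≟ + 0) λ { refl → ℕP.n≮0 B<k }))
                     (ℕP.*-zeroʳ (m ∸ used)))) ,
           total) ,
      λ k → ¬Spread⇒Meaning-universal {C = C k} (ψᵢ? k)
              (proj₂ (proj₂ (spreads k)) ∘ Spread-≤ (s≤s (ℕP.m≤m+n (size k) _)))
      where
      size : ℤ → ℕ
      size k = proj₁ (spreads k)
      size-0 : ∀ k → B < ℤ.∣ k ∣ → size k ≡ 0
      size-0 k B<k with spreads k
      ... | _ , ([] , l , _) , _ = sym l
      ... | _ , (_ ∷ _ , _ , _ , (mx , _) ∷ _) , _ = contradiction (M≤B mx) (ℕP.<⇒≱ B<k)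
      used : ℕ
      used = sumZ B size
      used≤m : used ≤ m
      used≤m = ℕP.≮⇒≥ λ m<used → Meaning-universal⇒¬Spread {C = Cᵍ} h (Spread-≤ m<used
        (Spread-concat (window-unique B) (λ k → proj₁ (proj₂ (spreads k)))
          (λ (mx , nx) (my , ny) → inside (proj₁ (good mx nx)) (proj₁ (good my ny)))
          (λ k≢ (mx , nx) (my , ny) → across k≢ (proj₁ (good mx nx)) (proj₁ (good my ny)))
          (λ (mx , nx) → M⊆ mx , proj₂ (good mx nx))))
      -- A plan has to sum to m exactly. The remainder goes to interval 0, which every window
      -- contains; raising `p k` only weakens the universal sentence there.
      p : ℤ → ℕ
      p k = size k + (m ∸ used) * χ (k ℤP.≟ + 0)
      total : sumZ B p ≡ m
      total = begin
        sumZ B p                                                  ≡⟨ ∑-+ (window B) size _ ⟩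
        used + ∑ (window B) (λ k → (m ∸ used) * χ (k ℤP.≟ + 0))   ≡⟨ cong (_+_ used)
                                                                       (∑-*ˡ (window B) (m ∸ used) _) ⟩
        used + (m ∸ used) * ∑ (window B) (λ k → χ (k ℤP.≟ + 0))   ≡⟨ cong (λ c → used + (m ∸ used) * c)
                                                                       (ℕP.≤-antisym
                                                                         (∑-χ≤1 (ℤP._≟ + 0) (window-unique B)
                                                                           λ e e' → trans e (sym e'))
                                                                         (1≤∑-χ (ℤP._≟ + 0)
                                                                           (∈-window {B} (+ 0) z≤n) refl)) ⟩
        used + (m ∸ used) * 1                                     ≡⟨ cong (_+_ used) (ℕP.*-identityʳ _) ⟩
        used + (m ∸ used)                                         ≡⟨ ℕP.m+[n∸m]≡n used≤m ⟩
        m ∎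
        where open ≡-Reasoning

open Plans

-- Arithmetic of intervals, covers and bad offsets.

module Offsets where

  open import Data.Integer using (_+_; _-_; _*_; _≤_; _<_)

  -- Linear integer inequalities are proved by exhibiting the slack of the
  -- conclusion as the sum of the slacks of the hypotheses.
  ≤-by₁ : ∀ {a b x y} → a ≤ b → y - x ≡ b - a → x ≤ y
  ≤-by₁ h e = ℤP.0≤i-j⇒j≤i (subst (+ 0 ≤_) (sym e) (ℤP.i≤j⇒0≤j-i h))

  ≤-by₂ : ∀ {a b c d x y} → a ≤ b → c ≤ d → y - x ≡ (b - a) + (d - c) → x ≤ y
  ≤-by₂ h k e = ℤP.0≤i-j⇒j≤i (subst (+ 0 ≤_) (sym e)
    (ℤP.+-mono-≤ (ℤP.i≤j⇒0≤j-i h) (ℤP.i≤j⇒0≤j-i k)))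

  ≤-by₃ : ∀ {a b c d e f x y} → a ≤ b → c ≤ d → e ≤ f →
    y - x ≡ (b - a) + (d - c) + (f - e) → x ≤ y
  ≤-by₃ h k l e = ℤP.0≤i-j⇒j≤i (subst (+ 0 ≤_) (sym e)
    (ℤP.+-mono-≤ (ℤP.+-mono-≤ (ℤP.i≤j⇒0≤j-i h) (ℤP.i≤j⇒0≤j-i k)) (ℤP.i≤j⇒0≤j-i l)))

  i+1≰i : ∀ {i} → ¬ i + + 1 ≤ i
  i+1≰i {i} h with ≤-by₁ {x = + 1} {+ 0} h (e i)
    where
    e : ∀ i → + 0 - + 1 ≡ i - (i + + 1)
    e = ℤSolver.solve-∀
  ... | +≤+ ()

  0≤+ : ∀ {n} → + 0 ≤ + n
  0≤+ = +≤+ z≤n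

  -- The intervals I, M_r(I) and M_2r(I) for the interval I starting at s, with ℓ = 2r + d.
  module Intervals (r d : ℕ) where

    R D : ℤ
    R = + r
    D = + d

    record InI (s z : ℤ) : Set where
      constructor _,_
      field
        lower : s ≤ z
        upper : z ≤ s + R + R + D - + 1

    record InM (s z : ℤ) : Set where
      constructor _,_
      field
        lower : s + R ≤ z
        upper : z ≤ s + R + D - + 1

    record InC (s z : ℤ) : Set where
      constructor _,_
      field
        lower : s + R + R ≤ z
        upper : z ≤ s + D - + 1

    InC⇒InM : ∀ {s z} → InC s z → InM s z
    InC⇒InM {s} {z} (lo , hi) =
      ≤-by₂ lo (0≤+ {r}) (e₁ s z R) , ≤-by₂ hi (0≤+ {r}) (e₂ s z R D)
      where
      e₁ : ∀ s z R → z - (s + R) ≡ (z - (s + R + R)) + (R - + 0)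
      e₁ = ℤSolver.solve-∀
      e₂ : ∀ s z R D → (s + R + D - + 1) - z ≡ (s + D - + 1 - z) + (R - + 0)
      e₂ = ℤSolver.solve-∀

    InM-near : ∀ {s z z'} → InM s z → z' ≤ z + R → z ≤ z' + R → InI s z'
    InM-near {s} {z} {z'} (lo , hi) z'≤ z≤ = ≤-by₂ lo z≤ (e₁ s z z' R) , ≤-by₂ hi z'≤ (e₂ s z z' R D)
      where
      e₁ : ∀ s z z' R → z' - s ≡ (z - (s + R)) + (z' + R - z)
      e₁ = ℤSolver.solve-∀
      e₂ : ∀ s z z' R D → (s + R + R + D - + 1) - z' ≡ (s + R + D - + 1 - z) + (z + R - z')
      e₂ = ℤSolver.solve-∀

    InC-near : ∀ {s z z'} → InC s z → z' ≤ z + (R + R) → z ≤ z' + (R + R) → InI s z'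
    InC-near {s} {z} {z'} (lo , hi) z'≤ z≤ = ≤-by₂ lo z≤ (e₁ s z z' R) , ≤-by₂ hi z'≤ (e₂ s z z' R D)
      where
      e₁ : ∀ s z z' R → z' - s ≡ (z - (s + R + R)) + (z' + (R + R) - z)
      e₁ = ℤSolver.solve-∀
      e₂ : ∀ s z z' R D → (s + R + R + D - + 1) - z' ≡ (s + D - + 1 - z) + (z + (R + R) - z')
      e₂ = ℤSolver.solve-∀

    InM⇒InI : ∀ {s z} → InM s z → InI s z
    InM⇒InI {s} {z} m = InM-near m z≤z+R z≤z+R
      where
      z≤z+R : z ≤ z + R
      z≤z+R = ℤP.i≤i+j z R

    InI? : ∀ s z → Dec (InI s z)
    InI? s z = map′ (λ (lo , hi) → lo , hi) (λ (lo , hi) → lo , hi)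
      ((s ℤP.≤? z) ×-dec (z ℤP.≤? s + R + R + D - + 1))

    InM? : ∀ s z → Dec (InM s z)
    InM? s z = map′ (λ (lo , hi) → lo , hi) (λ (lo , hi) → lo , hi)
      ((s + R ℤP.≤? z) ×-dec (z ℤP.≤? s + R + D - + 1))

    next≤ : ∀ {k k'} → k < k' → (+ 1 + k) * D ≤ k' * D
    next≤ k<k' = ℤP.*-monoʳ-≤-nonNeg D (ℤP.i<j⇒suc[i]≤j k<k')

    -- M_2r(I) ends at s + d - 1 and its successor begins at s + d + 2r. The difference 2r + 1 is
    -- just beyond the distance 2r in `Far`.
    across : ∀ {c k k' z z'} → k < k' → InC (c + k * D) z → InC (c + k' * D) z' →
      z + (R + R) + + 1 ≤ z'
    across {c} {k} {k'} {z} {z'} k<k' (_ , hi) (lo , _) =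
      ≤-by₃ lo hi (next≤ k<k') (e c k k' z z' R D)
      where
      e : ∀ c k k' z z' R D → z' - (z + (R + R) + + 1) ≡
        (z' - (c + k' * D + R + R)) + (c + k * D + D - + 1 - z) + (k' * D - (+ 1 + k) * D)
      e = ℤSolver.solve-∀

    module _ .{{d≢0 : ℕ.NonZero d}} where

      -- The sets M_r(I) of a cover are consecutive blocks of d layers, beginning with c + r for k =
      -- 0, so integer division finds the block of z.
      index : ℤ → ℤ → ℤ
      index c z = (z - c - R) DivMod./ℕ d

      InM-index : ∀ c z → InM (c + index c z * D) z
      InM-index c z =
        ≤-by₁ (0≤+ {ρ}) (trans (e₁ c (index c z) D R z)
          (trans (cong (_- index c z * D) w≡) (e₂ (+ ρ) (index c z * D)))) ,
        ≤-by₁ (ℤP.i<j⇒suc[i]≤j (+<+ (DivMod.n%ℕd<d w d)))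
          (trans (e₃ c (index c z) D R z)
          (trans (cong (λ w → index c z * D - w + D - + 1) w≡) (e₄ (+ ρ) (index c z * D) D)))
        where
        w = z - c - R
        ρ = w DivMod.%ℕ d
        w≡ : w ≡ + ρ + index c z * D
        w≡ = DivMod.a≡a%ℕn+[a/ℕn]*n w d
        e₁ : ∀ c k D R z → z - (c + k * D + R) ≡ (z - c - R) - k * D
        e₁ = ℤSolver.solve-∀
        e₂ : ∀ ρ q → (ρ + q) - q ≡ ρ - + 0
        e₂ = ℤSolver.solve-∀
        e₃ : ∀ c k D R z → (c + k * D + R + D - + 1) - z ≡ k * D - (z - c - R) + D - + 1
        e₃ = ℤSolver.solve-∀
        e₄ : ∀ ρ q D → q - (ρ + q) + D - + 1 ≡ D - (+ 1 + ρ)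
        e₄ = ℤSolver.solve-∀

      -- The right-hand side is shaped to fit under `bound`, with one layer in place of the sum over
      -- all vertices. The first step uses d ≥ 1.
      InI⇒∣k∣≤ : ∀ {c k z} → InI (c + k * D) z →
        ℤ.∣ k ∣ ℕ.≤ ℤ.∣ z ∣ ℕ.+ ℤ.∣ c ∣ ℕ.+ (2 ℕ.* r ℕ.+ d)
      InI⇒∣k∣≤ {c} {k} {z} (lo , hi) = begin
        ℤ.∣ k ∣                                     ≤⟨ ℕP.m≤m*n ℤ.∣ k ∣ d ⟩
        ℤ.∣ k ∣ ℕ.* d                               ≡⟨ ℤP.abs-* k D ⟨
        ℤ.∣ k * D ∣                                 ≡⟨ cong ℤ.∣_∣ (e₁ c (k * D) z) ⟩
        ℤ.∣ z - c - w ∣                             ≤⟨ ℤP.∣i-j∣≤∣i∣+∣j∣ (z - c) w ⟩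
        ℤ.∣ z - c ∣ ℕ.+ ℤ.∣ w ∣                     ≤⟨ ℕP.+-mono-≤ (ℤP.∣i-j∣≤∣i∣+∣j∣ z c) w≤ ⟩
        ℤ.∣ z ∣ ℕ.+ ℤ.∣ c ∣ ℕ.+ (2 ℕ.* r ℕ.+ d)     ∎
        where
        open ℕP.≤-Reasoning
        w = z - (c + k * D)
        e₁ : ∀ c q z → q ≡ z - c - (z - (c + q))
        e₁ = ℤSolver.solve-∀
        e₂ : ∀ s z R D → (R + (R + + 0) + D) - (z - s) ≡ (s + R + R + D - + 1 - z) + (+ 1 - + 0)
        e₂ = ℤSolver.solve-∀
        w≤ : ℤ.∣ w ∣ ℕ.≤ 2 ℕ.* r ℕ.+ d
        w≤ = ℤP.drop‿+≤+ (subst (_≤ + (2 ℕ.* r ℕ.+ d)) (sym (ℤP.0≤i⇒+∣i∣≡i (ℤP.i≤j⇒0≤j-i lo)))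
          (≤-by₂ hi (0≤+ {1}) (e₂ (c + k * D) z R D)))

      remainder-≮ : ∀ {a b k k'} → + a + k * D ≡ + b + k' * D → a ℕ.< d → ¬ k < k'
      remainder-≮ {a} {b} {k} {k'} e a<d k<k' =
        ℕP.<-irrefl refl (ℤP.drop‿+<+ (ℤP.<-≤-trans (+<+ a<d) D≤a))
        where
        e₁ : ∀ a k D → a - D ≡ (a + k * D) - k * D - D
        e₁ = ℤSolver.solve-∀
        e₂ : ∀ b k k' D → (b + k' * D) - k * D - D ≡ (k' * D - (+ 1 + k) * D) + (b - + 0)
        e₂ = ℤSolver.solve-∀
        D≤a : D ≤ + a
        D≤a = ≤-by₂ (next≤ k<k') (0≤+ {b}) (trans (e₁ (+ a) k D)
          (trans (cong (λ x → x - k * D - D) e) (e₂ (+ b) k k' D)))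

      %ℕ-unique : ∀ {w a} k → a ℕ.< d → w ≡ + a + k * D → w DivMod.%ℕ d ≡ a
      %ℕ-unique {w} {a} k a<d w≡ with ℤP.<-cmp k (w DivMod./ℕ d)
      ... | tri≈ _ refl _ = ℤP.+-injective
            (∙-cancelʳ ℤP.+-0-abelianGroup (k * D) _ _ (trans (sym (DivMod.a≡a%ℕn+[a/ℕn]*n w d)) w≡))
      ... | tri< k<q _ _ = contradiction k<q
            (remainder-≮ (trans (sym w≡) (DivMod.a≡a%ℕn+[a/ℕn]*n w d)) a<d)
      ... | tri> _ _ q<k = contradiction q<k
            (remainder-≮ (trans (sym (DivMod.a≡a%ℕn+[a/ℕn]*n w d)) w≡) (DivMod.n%ℕd<d w d))

      -- The offsets of the covers having an interval whose overlap with the next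
      -- one meets the 2r-neighbourhood of layer z.
      badOffsets : ℤ → List ℕ
      badOffsets z = map (λ j → (z + (R + R) - + j) DivMod.%ℕ d) (upTo (6 ℕ.* r))

      length-badOffsets : ∀ z → length (badOffsets z) ≡ 6 ℕ.* r
      length-badOffsets z = trans (ListP.length-map _ (upTo (6 ℕ.* r))) (ListP.length-upTo _)

      -- The overlap that begins at s = a + kD consists of 2r layers s, ..., s + 2r - 1. It meets z
      -- - 2r, ..., z + 2r only if s is one of z - 4r + 1, ..., z + 2r; these 6r starts are the
      -- source of the constant.
      ∈-badOffsets : ∀ {a k z} → a ℕ.< d → + a + k * D ≤ z + (R + R) →
        z + (R + R) + + 1 ≤ + a + k * D + + 6 * R → a ∈ badOffsets z
      ∈-badOffsets {a} {k} {z} a<d lo hi = subst (_∈ badOffsets z)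
        (%ℕ-unique {z + (R + R) - + j} k a<d
          (trans (cong (λ i → z + (R + R) - i) j≡) (e₁ (z + (R + R)) (+ a + k * D))))
        (∈-map⁺ _ (∈-upTo⁺ {i = j} j<))
        where
        j = ℤ.∣ z + (R + R) - (+ a + k * D) ∣
        j≡ : + j ≡ z + (R + R) - (+ a + k * D)
        j≡ = ℤP.0≤i⇒+∣i∣≡i (ℤP.i≤j⇒0≤j-i lo)
        e₁ : ∀ x y → x - (x - y) ≡ y
        e₁ = ℤSolver.solve-∀
        e₂ : ∀ x s R → + 6 * R - (+ 1 + (x - s)) ≡ (s + + 6 * R) - (x + + 1)
        e₂ = ℤSolver.solve-∀
        j< : j ℕ.< 6 ℕ.* r
        j< = ℤP.drop‿+≤+ (subst₂ _≤_ (cong (_+_ (+ 1)) (sym j≡)) (sym (ℤP.pos-* 6 r))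
          (≤-by₁ hi (e₂ (z + (R + R)) (+ a + k * D) R)))

      -- A layer of M_r(I) outside M_2r(I) lies in the overlap with the previous or the next
      -- interval. If it is also within 2r of z, that overlap makes the offset bad for z.
      InM⇒InC : ∀ {a k z z'} → a ℕ.< d → a ∉ badOffsets z →
        z ≤ z' + (R + R) → z' ≤ z + (R + R) → InM (+ a + k * D) z' → InC (+ a + k * D) z'
      InM⇒InC {a} {k} {z} {z'} a<d a∉ z≤ z'≤ (lo , hi) = lo' , hi'
        where
        s = + a + k * D
        lo' : s + R + R ≤ z'
        lo' = ℤP.≮⇒≥ λ z'<  → a∉ (∈-badOffsets {k = k} {z} a<d
          (≤-by₃ lo z'≤ (0≤+ {r}) (e₁ s z z' R))
          (≤-by₂ (ℤP.i<j⇒suc[i]≤j z'<) z≤ (e₂ s z z' R)))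
          where
          e₁ : ∀ s z z' R → z + (R + R) - s ≡ (z' - (s + R)) + (z + (R + R) - z') + (R - + 0)
          e₁ = ℤSolver.solve-∀
          e₂ : ∀ s z z' R → s + + 6 * R - (z + (R + R) + + 1) ≡
            (s + R + R - (+ 1 + z')) + (z' + (R + R) - z)
          e₂ = ℤSolver.solve-∀
        hi' : z' ≤ s + D - + 1
        -- The overlap at the upper end begins where the next interval does, hence the index k + 1.
        hi' = ℤP.≮⇒≥ λ <z' → a∉ (∈-badOffsets {k = k + + 1} {z} a<d
          (≤-by₂ (ℤP.i<j⇒suc[i]≤j <z') z'≤ (e₁ (+ a) k z z' R D))
          (≤-by₃ hi z≤ (0≤+ {r}) (e₂ (+ a) k z z' R D)))
          where
          e₁ : ∀ a k z z' R D → z + (R + R) - (a + (k + + 1) * D) ≡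
            (z' - (+ 1 + (a + k * D + D - + 1))) + (z + (R + R) - z')
          e₁ = ℤSolver.solve-∀
          e₂ : ∀ a k z z' R D → a + (k + + 1) * D + + 6 * R - (z + (R + R) + + 1) ≡
            (a + k * D + R + D - + 1 - z') + (z' + (R + R) - z) + (R - + 0)
          e₂ = ℤSolver.solve-∀

      -- Counting (offset, interval) pairs containing z by their start, which is
      -- one of z - ℓ + 1, …, z.
      total-multiplicity : (W : ℕ → List ℤ) → (∀ a → Unique (W a)) → ∀ z →
        ∑ (upTo d) (λ a → ∑ (W a) λ k → χ (InI? (+ a + k * D) z)) ℕ.≤ 2 ℕ.* r ℕ.+ d
      total-multiplicity W W-unique z = begin
        ∑ (upTo d) (λ a → ∑ (W a) λ k → χ (InI? (+ a + k * D) z))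
          ≤⟨ ∑-mono (upTo d) (λ {a} _ → ∑-mono (W a) λ {k} _ → start-in a k) ⟩
        ∑ (upTo d) (λ a → ∑ (W a) λ k → ∑ (upTo ℓ) λ j → hit j a k)
          ≡⟨ ∑-cong (upTo d) (λ {a} _ → ∑-swap (W a) (upTo ℓ) (λ k j → hit j a k)) ⟩
        ∑ (upTo d) (λ a → ∑ (upTo ℓ) λ j → ∑ (W a) λ k → hit j a k)
          ≡⟨ ∑-swap (upTo d) (upTo ℓ) (λ a j → ∑ (W a) λ k → hit j a k) ⟩
        ∑ (upTo ℓ) (λ j → ∑ (upTo d) λ a → ∑ (W a) λ k → hit j a k)
          ≤⟨ ∑-mono (upTo ℓ) (λ {j} _ → ℕP.≤-trans
               (∑-mono (upTo d) (λ {a} a∈ → one-offset j a (∈-upTo⁻ a∈)))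
               (∑-χ≤1 (λ a → (z - + j) DivMod.%ℕ d ℕP.≟ a) (UniqueP.upTo⁺ d)
                 (λ e e' → trans (sym e) e'))) ⟩
        ∑ (upTo ℓ) (λ _ → 1)
          ≡⟨ ∑-length (upTo ℓ) ⟩
        length (upTo ℓ)
          ≡⟨ ListP.length-upTo ℓ ⟩
        ℓ ∎
        where
        open ℕP.≤-Reasoning
        ℓ = 2 ℕ.* r ℕ.+ d
        hit? : ∀ j a k → Dec (z - + j ≡ + a + k * D)
        hit? j a k = z - + j ℤP.≟ + a + k * D
        hit : ℕ → ℕ → ℤ → ℕ
        hit j a k = χ (hit? j a k)
        start-in : ∀ a k → χ (InI? (+ a + k * D) z) ℕ.≤ ∑ (upTo ℓ) λ j → hit j a k
        start-in a k with InI? (+ a + k * D) z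
        ... | no _ = z≤n
        ... | yes (lo , hi) = 1≤∑-χ (λ j → hit? j a k) {x = j} (∈-upTo⁺ j<)
                (trans (cong (λ i → z - i) j≡) (e₁ z s))
          where
          s = + a + k * D
          j = ℤ.∣ z - s ∣
          j≡ : + j ≡ z - s
          j≡ = ℤP.0≤i⇒+∣i∣≡i (ℤP.i≤j⇒0≤j-i lo)
          e₁ : ∀ x y → x - (x - y) ≡ y
          e₁ = ℤSolver.solve-∀
          e₂ : ∀ s z R D → (R + (R + + 0) + D) - (+ 1 + (z - s)) ≡ s + R + R + D - + 1 - z
          e₂ = ℤSolver.solve-∀
          j< : j ℕ.< ℓ
          j< = ℤP.drop‿+≤+ (subst (_≤ + ℓ) (cong (_+_ (+ 1)) (sym j≡)) (≤-by₁ hi (e₂ s z R D)))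
        -- The start z - j is congruent modulo d to a single offset, and for that offset it
        -- determines k.
        one-offset : ∀ j a → a ℕ.< d →
          ∑ (W a) (λ k → hit j a k) ℕ.≤ χ ((z - + j) DivMod.%ℕ d ℕP.≟ a)
        one-offset j a a<d with (z - + j) DivMod.%ℕ d ℕP.≟ a
        ... | yes _ = ∑-χ≤1 (hit? j a) (W-unique a) λ e e' →
                ℤP.*-cancelʳ-≡ _ _ D (∙-cancelˡ ℤP.+-0-abelianGroup (+ a) _ _ (trans (sym e) e'))
        ... | no ≢a = ℕP.≤-reflexive (trans
                (∑-cong (W a) λ {k} _ → χ-no (hit? j a k) λ e → ≢a (%ℕ-unique k a<d e))
                (trans (∑-const (W a) 0) (ℕP.*-zeroʳ (length (W a)))))

open Offsets

-- Double counting over all covers and the choice of a cheap good one.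

module Averaging where

  open import Data.Nat using (_+_; _*_; _∸_; _≤_; _<_)

  χ-cong : ∀ {A B : Set} (a : Dec A) (b : Dec B) → (A → B) → (B → A) → χ a ≡ χ b
  χ-cong (yes a) b f g = sym (χ-yes b (f a))
  χ-cong (no ¬a) b f g = sym (χ-no b (¬a ∘ g))

  χ-* : ∀ {A B C : Set} (a : Dec A) (b : Dec B) (c : Dec C) → (A → B × C) → (B × C → A) →
    χ a ≡ χ b * χ c
  χ-* a (yes y) (yes z) f g = χ-yes a (g (y , z))
  χ-* a (yes y) (no ¬z) f g = χ-no a (¬z ∘ proj₂ ∘ f)
  χ-* a (no ¬y) c f g = χ-no a (¬y ∘ proj₁ ∘ f)

  ∣p∣≡∑ : ∀ {n} (p : Subset n) → ∣ p ∣ ≡ ∑ (allFin n) (λ x → χ (x SubP.∈? p))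
  ∣p∣≡∑ Vec.[] = refl
  ∣p∣≡∑ (s Vec.∷ p) = trans (head s) (cong (_+_ (χ (zero SubP.∈? (s Vec.∷ p)))) (trans (∣p∣≡∑ p) (trans
      (∑-cong (allFin _) λ {x} _ → χ-cong (x SubP.∈? p) (suc x SubP.∈? (s Vec.∷ p))
        Vec.there λ { (Vec.there x∈) → x∈ })
      (tail (λ x → χ (x SubP.∈? (s Vec.∷ p)))))))
    where
    tail : ∀ {n} (f : Fin (suc n) → ℕ) → ∑ (allFin n) (f ∘ suc) ≡ ∑ (tabulate suc) f
    tail f = cong sum (trans (ListP.map-tabulate id (f ∘ suc)) (sym (ListP.map-tabulate suc f)))
    head : ∀ s → ∣ s Vec.∷ p ∣ ≡ χ (zero SubP.∈? (s Vec.∷ p)) + ∣ p ∣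
    head true = refl
    head false = refl

  module _ {A : Set} (_≟_ : DecidableEquality A) where

    open DecMembership _≟_ using (_∈?_)

    -- Every element survives the filter or equals some member of `bs`; as `xs` has no repetitions,
    -- each member of `bs` accounts for at most one loss.
    length≤filter∉+length : ∀ {xs} bs → Unique xs →
      length xs ≤ length (filter (λ x → ¬? (x ∈? bs)) xs) + length bs
    length≤filter∉+length {xs} bs u = begin
      length xs                                                       ≡⟨ ∑-length xs ⟨
      ∑ xs (λ _ → 1)                                                  ≤⟨ ∑-mono xs (λ {x} _ → covered x) ⟩
      ∑ xs (λ x → χ (¬? (x ∈? bs)) + ∑ bs (λ b → χ (x ≟ b)))          ≡⟨ ∑-+ xs _ _ ⟩
      ∑ xs (λ x → χ (¬? (x ∈? bs))) + ∑ xs (λ x → ∑ bs λ b → χ (x ≟ b))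
        ≡⟨ cong₂ _+_ (∑-χ-length (λ x → ¬? (x ∈? bs)) xs) (∑-swap xs bs (λ x b → χ (x ≟ b))) ⟩
      length (filter (λ x → ¬? (x ∈? bs)) xs) + ∑ bs (λ b → ∑ xs λ x → χ (x ≟ b))
        ≤⟨ ℕP.+-monoʳ-≤ _ (∑-mono bs λ {b} _ → ∑-χ≤1 (_≟ b) u λ e e' → trans e (sym e')) ⟩
      length (filter (λ x → ¬? (x ∈? bs)) xs) + ∑ bs (λ _ → 1)        ≡⟨ cong (_+_ _) (∑-length bs) ⟩
      length (filter (λ x → ¬? (x ∈? bs)) xs) + length bs             ∎
      where
      open ℕP.≤-Reasoning
      covered : ∀ x → 1 ≤ χ (¬? (x ∈? bs)) + ∑ bs (λ b → χ (x ≟ b))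
      covered x with x ∈? bs
      ... | yes x∈ = 1≤∑-χ (x ≟_) x∈ refl
      ... | no _ = s≤s z≤n

  ∑-filter-≤ : ∀ {A : Set} {P : A → Set} (P? : Decidable P) xs (f : A → ℕ) →
    ∑ (filter P? xs) f ≤ ∑ xs f
  ∑-filter-≤ P? [] f = z≤n
  ∑-filter-≤ P? (x ∷ xs) f with P? x
  ... | yes _ = ℕP.+-monoʳ-≤ (f x) (∑-filter-≤ P? xs f)
  ... | no _ = ℕP.m≤n⇒m≤o+n (f x) (∑-filter-≤ P? xs f)

  module _ (r d : ℕ) .{{d≢0 : ℕ.NonZero d}} where

    open DecMembership ℕP._≟_ using (_∈?_)
    open Intervals r d using (D; InI; InI?; InM-index; InM⇒InI; index; badOffsets;
      length-badOffsets; total-multiplicity)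

    private
      ℓ = 2 * r + d

    module _ {N : ℕ} (layer : Fin N → ℤ) (B : Subset N) (W : ℕ → List ℤ)
             (W-unique : ∀ a → Unique (W a)) (index∈W : ∀ a x → index (+ a) (layer x) ∈ W a)
             (S : ℕ → ℤ → Subset N)
             (∈S : ∀ a k x → x ∈ˢ S a k ⇔ InI (+ a ℤ.+ k ℤ.* D) (layer x)) where

      cost : ℕ → ℕ
      cost a = ∑ (W a) λ k → ∣ B ∩ S a k ∣

      private
        χB : Fin N → ℕ
        χB x = χ (x SubP.∈? B)
        mult : ℕ → Fin N → ℕ
        mult a x = ∑ (W a) λ k → χ (InI? (+ a ℤ.+ k ℤ.* D) (layer x))

        cost≡ : ∀ a → cost a ≡ ∑ (allFin N) λ x → χB x * mult a x
        cost≡ a = begin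
          ∑ (W a) (λ k → ∣ B ∩ S a k ∣)
            ≡⟨ ∑-cong (W a) (λ {k} _ → trans (∣p∣≡∑ (B ∩ S a k)) (∑-cong (allFin N) λ {x} _ →
                 χ-* (x SubP.∈? (B ∩ S a k)) (x SubP.∈? B) (InI? (+ a ℤ.+ k ℤ.* D) (layer x))
                   (λ x∈ → let b , s = SubP.x∈p∩q⁻ B (S a k) x∈ in b , to (∈S a k x) s)
                   (λ (b , s) → SubP.x∈p∩q⁺ (b , from (∈S a k x) s)))) ⟩
          ∑ (W a) (λ k → ∑ (allFin N) λ x → χB x * χ (InI? (+ a ℤ.+ k ℤ.* D) (layer x)))
            ≡⟨ ∑-swap (W a) (allFin N) _ ⟩
          ∑ (allFin N) (λ x → ∑ (W a) λ k → χB x * χ (InI? (+ a ℤ.+ k ℤ.* D) (layer x)))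
            ≡⟨ ∑-cong (allFin N) (λ {x} _ → ∑-*ˡ (W a) (χB x) _) ⟩
          ∑ (allFin N) (λ x → χB x * mult a x) ∎
          where open ≡-Reasoning

        -- Every vertex lies in the interval given by `index`, hence is counted at least once. This
        -- makes the truncated subtraction in `excess` a genuine difference.
        ∣B∣≤cost : ∀ a → ∣ B ∣ ≤ cost a
        ∣B∣≤cost a = begin
          ∣ B ∣                                 ≡⟨ ∣p∣≡∑ B ⟩
          ∑ (allFin N) χB                       ≡⟨ ∑-cong (allFin N) (λ _ → sym (ℕP.*-identityʳ _)) ⟩
          ∑ (allFin N) (λ x → χB x * 1)         ≤⟨ ∑-mono (allFin N) (λ {x} _ → ℕP.*-monoʳ-≤ (χB x)
                                                     (1≤∑-χ (λ k → InI? (+ a ℤ.+ k ℤ.* D) (layer x))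
                                                       (index∈W a x) (InM⇒InI (InM-index (+ a) (layer x))))) ⟩
          ∑ (allFin N) (λ x → χB x * mult a x)  ≡⟨ cost≡ a ⟨
          cost a                                ∎
          where open ℕP.≤-Reasoning

        total-cost : ∑ (upTo d) cost ≤ ℓ * ∣ B ∣
        total-cost = begin
          ∑ (upTo d) cost                                         ≡⟨ ∑-cong (upTo d) (λ {a} _ → cost≡ a) ⟩
          ∑ (upTo d) (λ a → ∑ (allFin N) λ x → χB x * mult a x)   ≡⟨ ∑-swap (upTo d) (allFin N) _ ⟩
          ∑ (allFin N) (λ x → ∑ (upTo d) λ a → χB x * mult a x)   ≡⟨ ∑-cong (allFin N) (λ {x} _ →
                                                               ∑-*ˡ (upTo d) (χB x) _) ⟩
          ∑ (allFin N) (λ x → χB x * ∑ (upTo d) λ a → mult a x)   ≤⟨ ∑-mono (allFin N) (λ {x} _ → ℕP.*-monoʳ-≤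
                                                               (χB x) (total-multiplicity W W-unique (layer x))) ⟩
          ∑ (allFin N) (λ x → χB x * ℓ)                           ≡⟨ ∑-cong (allFin N) (λ {x} _ → ℕP.*-comm (χB x) ℓ) ⟩
          ∑ (allFin N) (λ x → ℓ * χB x)                           ≡⟨ ∑-*ˡ (allFin N) ℓ χB ⟩
          ℓ * ∑ (allFin N) χB                                     ≡⟨ cong (ℓ *_) (∣p∣≡∑ B) ⟨
          ℓ * ∣ B ∣                                                     ∎
          where open ℕP.≤-Reasoning

        -- The quantity averaged over good offsets: its non-negative terms allow the sum over these
        -- to be bounded by the sum over all offsets.
        excess : ℕ → ℕ
        excess a = cost a ∸ ∣ B ∣

        -- All d offsets together cost at most ℓ = 2r + d times |B|, and d|B| of this is subtracted
        -- again.
        total-excess : ∑ (upTo d) excess ≤ 2 * r * ∣ B ∣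
        total-excess = ℕP.+-cancelʳ-≤ (d * ∣ B ∣) _ _ (begin
          ∑ (upTo d) excess + d * ∣ B ∣                      ≡⟨ cong (λ n → ∑ (upTo d) excess + n * ∣ B ∣)
                                                                  (ListP.length-upTo d) ⟨
          ∑ (upTo d) excess + length (upTo d) * ∣ B ∣        ≡⟨ cong (_+_ (∑ (upTo d) excess)) (∑-const (upTo d) ∣ B ∣) ⟨
          ∑ (upTo d) excess + ∑ (upTo d) (λ _ → ∣ B ∣)       ≡⟨ ∑-+ (upTo d) _ _ ⟨
          ∑ (upTo d) (λ a → excess a + ∣ B ∣)                ≡⟨ ∑-cong (upTo d) (λ {a} _ → ℕP.m∸n+n≡m (∣B∣≤cost a)) ⟩
          ∑ (upTo d) cost                                    ≤⟨ total-cost ⟩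
          ℓ * ∣ B ∣                                          ≡⟨ ℕP.*-distribʳ-+ ∣ B ∣ (2 * r) d ⟩
          2 * r * ∣ B ∣ + d * ∣ B ∣                          ∎)
          where open ℕP.≤-Reasoning

      -- Fewer than half of the offsets are bad, so the excesses of the good ones
      -- average to at most twice the overall average 2r|B| / d.
      good-offset : (anchors : List ℤ) → 2 * (length anchors * (6 * r)) < d →
        Σ ℕ λ a → a < d × (∀ z → z ∈ anchors → a ∉ badOffsets z) ×
          d * (cost a ∸ ∣ B ∣) ≤ 4 * r * ∣ B ∣
      good-offset anchors few = result (∑-average good excess 0<g)
        where
        bad good : List ℕ
        bad = concat (map badOffsets anchors)
        good = filter (λ a → ¬? (a ∈? bad)) (upTo d)
        g = length good
        length-bad : length bad ≡ length anchors * (6 * r)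
        length-bad = trans (length-concat-map badOffsets anchors)
          (trans (∑-cong anchors λ {z} _ → length-badOffsets z) (∑-const anchors (6 * r)))
        d≤g+bad : d ≤ g + length bad
        d≤g+bad = subst (_≤ g + length bad) (ListP.length-upTo d)
          (length≤filter∉+length ℕP._≟_ bad (UniqueP.upTo⁺ d))
        d<2g : d < 2 * g
        d<2g = ℕP.+-cancelʳ-< d d (2 * g) (begin-strict
          d + d                      ≡⟨ cong (_+_ d) (ℕP.+-identityʳ d) ⟨
          2 * d                      ≤⟨ ℕP.*-monoʳ-≤ 2 d≤g+bad ⟩
          2 * (g + length bad)       ≡⟨ ℕP.*-distribˡ-+ 2 g (length bad) ⟩
          2 * g + 2 * length bad     <⟨ ℕP.+-monoʳ-< (2 * g)
                                          (subst (λ b → 2 * b < d) (sym length-bad) few) ⟩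
          2 * g + d                  ∎)
          where open ℕP.≤-Reasoning
        0<g : 0 < g
        0<g = ℕP.*-cancelˡ-< 2 0 g (ℕP.≤-<-trans z≤n d<2g)
        result : (Σ ℕ λ a → a ∈ good × g * excess a ≤ ∑ good excess) → _
        result (a , a∈ , le) = a , ∈-upTo⁻ (proj₁ (∈-filter⁻ (λ a → ¬? (a ∈? bad)) {xs = upTo d} a∈)) ,
          (λ z z∈ a∈bad → proj₂ (∈-filter⁻ (λ a → ¬? (a ∈? bad)) {xs = upTo d} a∈)
             (∈-concat⁺′ a∈bad (∈-map⁺ badOffsets z∈))) ,
          (begin
            d * excess a             ≤⟨ ℕP.*-monoˡ-≤ (excess a) (ℕP.<⇒≤ d<2g) ⟩
            2 * g * excess a         ≡⟨ ℕP.*-assoc 2 g (excess a) ⟩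
            2 * (g * excess a)       ≤⟨ ℕP.*-monoʳ-≤ 2 (ℕP.≤-trans le (ℕP.≤-trans
                                          (∑-filter-≤ (λ a → ¬? (a ∈? bad)) (upTo d) excess) total-excess)) ⟩
            2 * (2 * r * ∣ B ∣)      ≡⟨ twice r ∣ B ∣ ⟩
            4 * r * ∣ B ∣            ∎)
          where
          open ℕP.≤-Reasoning
          twice : ∀ r b → 2 * (2 * r * b) ≡ 4 * r * b
          twice = ℕSolver.solve-∀

open Averaging

-- Layers, intervals and satisfaction in G_I.

module Covers where

  open import Data.Integer using (_+_; _-_; _*_; _≤_)

  ∣i∣≤n⇒i≤n : ∀ {i n} → ℤ.∣ i ∣ ℕ.≤ n → i ≤ + n
  ∣i∣≤n⇒i≤n {+ _} le = +≤+ le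
  ∣i∣≤n⇒i≤n { -[1+ _ ]} le = -≤+

  ⌊⌋∧⌊⌋ : ∀ {A B : Set} (a : Dec A) (b : Dec B) → (⌊ a ⌋ ∧ ⌊ b ⌋ ≡ true) ⇔ (A × B)
  ⌊⌋∧⌊⌋ (yes a) (yes b) = mk⇔ (λ _ → a , b) (λ _ → refl)
  ⌊⌋∧⌊⌋ (yes a) (no ¬b) = mk⇔ (λ ()) (λ (_ , b) → contradiction b ¬b)
  ⌊⌋∧⌊⌋ (no ¬a) b = mk⇔ (λ ()) (λ (a , _) → contradiction a ¬a)

  ∈-preimage : ∀ {k} (f : Fin k → ℤ) lo hi x → x ∈ˢ preimage f lo hi ⇔ (lo ≤ f x × f x ≤ hi)
  ∈-preimage f lo hi x = mk⇔
    (λ x∈ → trans (sym (VecP.lookup∘tabulate _ x)) (VecP.[]=⇒lookup x∈))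
    (λ e → VecP.lookup⇒[]= x _ (trans (VecP.lookup∘tabulate _ x) e))
    ⇔∘ ⌊⌋∧⌊⌋ (lo ℤP.≤? f x) (f x ℤP.≤? hi)

  f≤maxFin : ∀ k (f : Fin k → ℕ) i → f i ℕ.≤ maxFin k f
  f≤maxFin (suc k) f zero = ℕP.m≤m⊔n (f zero) _
  f≤maxFin (suc k) f (suc i) = ℕP.≤-trans (f≤maxFin k (f ∘ suc) i) (ℕP.m≤n⊔m (f zero) _)

  module _ {k} (f : Fin k → ℤ) (r d : ℕ) (s : ℤ) (x : Fin k) where

    open Intervals r d

    private
      ℓ = 2 ℕ.* r ℕ.+ d

      Mset⇔ : ∀ a {lo hi} {In : Set} → s + + a ≡ lo → s + + ℓ - + a - + 1 ≡ hi →
        (lo ≤ f x × f x ≤ hi) ⇔ In → x ∈ˢ Mset f ℓ s a ⇔ In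
      Mset⇔ a refl refl = ∈-preimage f _ _ x ⇔∘_

    ∈-Mset-I : x ∈ˢ Mset f ℓ s 0 ⇔ InI s (f x)
    ∈-Mset-I = Mset⇔ 0 (ℤP.+-identityʳ s) (e s R D)
      (mk⇔ (λ (lo , hi) → lo , hi) (λ (lo , hi) → lo , hi))
      where
      e : ∀ s R D → s + (R + (R + + 0) + D) - + 0 - + 1 ≡ s + R + R + D - + 1
      e = ℤSolver.solve-∀

    ∈-Mset-M : x ∈ˢ Mset f ℓ s r ⇔ InM s (f x)
    ∈-Mset-M = Mset⇔ r refl (e s R D) (mk⇔ (λ (lo , hi) → lo , hi) (λ (lo , hi) → lo , hi))
      where
      e : ∀ s R D → s + (R + (R + + 0) + D) - R - + 1 ≡ s + R + D - + 1
      e = ℤSolver.solve-∀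

    ∈-Mset-C : x ∈ˢ Mset f ℓ s (2 ℕ.* r) ⇔ InC s (f x)
    ∈-Mset-C = Mset⇔ (2 ℕ.* r) (e₁ s R) (e₂ s R D)
      (mk⇔ (λ (lo , hi) → lo , hi) (λ (lo , hi) → lo , hi))
      where
      e₁ : ∀ s R → s + (R + (R + + 0)) ≡ s + R + R
      e₁ = ℤSolver.solve-∀
      e₂ : ∀ s R D → s + (R + (R + + 0) + D) - (R + (R + + 0)) - + 1 ≡ s + D - + 1
      e₂ = ℤSolver.solve-∀

  module Layered {u} (G : LGraph u) (layer : Fin (N G) → ℤ) (layering : IsLayering G layer) where

    -- Two inequalities in place of an absolute value, in the form that the slack arithmetic takes
    -- as hypotheses.
    record Near (a : ℕ) (x y : Fin (N G)) : Set where
      constructor _,_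
      field
        forth : layer y ≤ layer x + + a
        back  : layer x ≤ layer y + + a

    Near-refl : ∀ {a x} → Near a x x
    Near-refl {a} {x} = ℤP.i≤i+j (layer x) (+ a) , ℤP.i≤i+j (layer x) (+ a)

    Near-≤ : ∀ {a b x y} → a ℕ.≤ b → Near a x y → Near b x y
    Near-≤ {a} {b} {x} {y} a≤b (p , q) =
      ℤP.≤-trans p (ℤP.+-monoʳ-≤ (layer x) (+≤+ a≤b)) ,
      ℤP.≤-trans q (ℤP.+-monoʳ-≤ (layer y) (+≤+ a≤b))

    Near-edge : ∀ {x y} → adjG G x y ≡ true → Near 1 x y
    Near-edge {x} {y} xy =
      ≤-by₁ (∣i∣≤n⇒i≤n {layer y - layer x}
          (subst (ℕ._≤ 1) (ℤP.∣i-j∣≡∣j-i∣ (layer x) (layer y)) (layering x y xy)))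
        (e (layer x) (layer y)) ,
      ≤-by₁ (∣i∣≤n⇒i≤n {layer x - layer y} (layering x y xy)) (e (layer y) (layer x))
      where
      e : ∀ x y → x + + 1 - y ≡ + 1 - (y - x)
      e = ℤSolver.solve-∀

    Near-step : ∀ {a x y z} → Near a x y → Near 1 y z → Near (suc a) x z
    Near-step {a} {x} {y} {z} (p , p') (q , q') =
      ≤-by₂ p q (e (layer x) (layer y) (layer z) (+ a)) ,
      ≤-by₂ p' q' (e' (layer x) (layer y) (layer z) (+ a))
      where
      e : ∀ x y z a → x + (+ 1 + a) - z ≡ (x + a - y) + (y + + 1 - z)
      e = ℤSolver.solve-∀
      e' : ∀ x y z a → z + (+ 1 + a) - x ≡ (y + a - x) + (z + + 1 - y)
      e' = ℤSolver.solve-∀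

    module _ {w} (D : Subset (N G)) (Q : Fin w → Subset (N G)) where

      sub : Interp w
      sub = record { n = N G ; dom = D ; E = adjG G ; P = Q }

      Dist⇒Near : ∀ a {x y} → Dist sub a x y → Near a x y
      Dist⇒Near zero refl = Near-refl
      Dist⇒Near (suc a) {x} {y} (z , _ , xz , zy) =
        Near-step (Dist⇒Near a xz) (step zy)
        where
        step : z ≡ y ⊎ adjG G z y ≡ true → Near 1 z y
        step (inj₁ refl) = Near-refl
        step (inj₂ e) = Near-edge e

    -- A walk of length at most a from `x` never leaves the layers within a of that of `x`, so `D'`
    -- has to contain only those vertices of `D`.
    Dist-grow : ∀ {w w'} {D D' : Subset (N G)}
      {Q : Fin w → Subset (N G)} {Q' : Fin w' → Subset (N G)} a {x y} →
      (∀ z → Near a x z → z ∈ˢ D → z ∈ˢ D') → Dist (sub D Q) a x y → Dist (sub D' Q') a x y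
    Dist-grow zero h e = e
    Dist-grow {D = D} {D'} {Q} {Q'} (suc a) {x} h (z , z∈ , xz , zy) =
      z , h z (Near-≤ (ℕP.n≤1+n a) (Dist⇒Near D Q a xz)) z∈ ,
      Dist-grow {Q = Q} {Q'} a (λ y near → h y (Near-≤ (ℕP.n≤1+n a) near)) xz , zy

  module Cover {u} (G : LGraph u) (layer : Fin (N G) → ℤ) (r d : ℕ) where

    open Intervals r d

    ℓ = 2 ℕ.* r ℕ.+ d
    V = Fin (N G)

    I : ℤ → ℤ → Interp (suc (suc u))
    I c k = G_I G layer ℓ r (start ℓ r c k)

    start≡ : ∀ c k → start ℓ r c k ≡ c + k * D
    start≡ c k = cong (λ n → c + k * + n) (ℕP.m+n∸m≡n (2 ℕ.* r) d)

    module _ (c k : ℤ) (x : V) where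

      private
        s = c + k * D
        start⇔ : ∀ {Q : ℤ → Set} → Q (start ℓ r c k) ⇔ Q s
        start⇔ {Q} = mk⇔ (subst Q (start≡ c k)) (subst Q (sym (start≡ c k)))

      dom⇔InI : x ∈ˢ dom (I c k) ⇔ InI s (layer x)
      dom⇔InI = mk⇔ (λ x∈ → proj₂ (SubP.x∈p∩q⁻ Sub.⊤ _ x∈)) (λ x∈ → SubP.x∈p∩q⁺ (SubP.∈⊤ , x∈))
        ⇔∘ ∈-Mset-I layer r d _ x ⇔∘ start⇔ {λ s → InI s (layer x)}

      C⇔ : (x ∈ˢ dom (I c k) × x ∈ˢ Mset layer ℓ (start ℓ r c k) (2 ℕ.* r)) ⇔ InC s (layer x)
      C⇔ = mk⇔ (λ (_ , x∈) → to C x∈)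
                (λ i → from dom⇔InI (InM⇒InI (InC⇒InM i)) , from C i)
        where
        C = ∈-Mset-C layer r d _ x ⇔∘ start⇔ {λ s → InC s (layer x)}

      M⇔ : (x ∈ˢ dom (I c k) × x ∈ˢ Mset layer ℓ (start ℓ r c k) r) ⇔ InM s (layer x)
      M⇔ = mk⇔ (λ (_ , x∈) → to M x∈) (λ i → from dom⇔InI (InM⇒InI i) , from M i)
        where
        M = ∈-Mset-M layer r d _ x ⇔∘ start⇔ {λ s → InM s (layer x)}

  -- A single term: local against global satisfaction, gluing and local plans.

  module Term {u} (G : LGraph u) (layer : Fin (N G) → ℤ) (layering : IsLayering G layer)
              (r d : ℕ) .{{d≢0 : ℕ.NonZero d}}
              (β : Basic u) (range≤r : range β ℕ.≤ r) (occ : Occ true (basicSentence β)) where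

    open Layered G layer layering
    open Intervals r d
    open Cover G layer r d

    ψ : Local (suc u) (range β) 0
    ψ = core⁺ (kind β) (spread β) (core β)

    occ-ψ : Occ true (toF ψ)
    occ-ψ = Occ-core⁺ β occ

    H : Subset (N G) → Interp (suc u)
    H A = asInterp G ,:= A

    K : ℤ → ℤ → Subset (N G) → Interp (suc (suc (suc u)))
    K c k A = I c k ,:= A

    C M : ℤ → ℤ → V → Set
    C c k x = InC (c + k * D) (layer x)
    M c k x = InM (c + k * D) (layer x)

    Sat-variant⁺ : ∀ c k A {q} → q ℕ.≤ spread β → K c k A ⊨ variant β q ⇔
      Meaning (kind β) q (Far (K c k A) (2 ℕ.* range β)) (C c k) (M c k)
        (Holds (reduct embedXL (K c k A)) ψ)
    Sat-variant⁺ c k A q≤ = Sat-variant (K c k A) β _ (C⇔ c k) (M⇔ c k) ⇔∘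
      Meaning-core⁺ {H = reduct embedXL (K c k A)} {C = C c k} {M = M c k} (kind β) (core β) q≤

    Sat-basicSentence⁺ : ∀ A → H A ⊨ basicSentence β ⇔
      Meaning (kind β) (spread β) (Far (H A) (2 ℕ.* range β)) (_∈ˢ Sub.⊤) (_∈ˢ Sub.⊤) (Holds (H A) ψ)
    Sat-basicSentence⁺ A = Sat-basicSentence (H A) β ⇔∘
      Meaning-core⁺ {H = H A} {C = _∈ˢ Sub.⊤} {M = _∈ˢ Sub.⊤} (kind β) (core β) ℕP.≤-refl

    Near-2r : ∀ {x y} → Near (2 ℕ.* range β) x y →
      layer y ≤ layer x + (R + R) × layer x ≤ layer y + (R + R)
    Near-2r {x} {y} near with Near-≤ (ℕP.*-monoʳ-≤ 2 range≤r) near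
    ... | p , q = subst (λ n → layer y ≤ layer x + + n) 2r≡ p , subst (λ n → layer x ≤ layer y + + n) 2r≡ q
      where
      2r≡ = cong (r ℕ.+_) (ℕP.+-identityʳ r)

    module _ {c k : ℤ} {A A' : Subset (N G)} where

      private
        Hᵢ = reduct embedXL (K c k A')

      Far-local : ∀ {x y} → Far (H A) (2 ℕ.* range β) x y → Far (K c k A') (2 ℕ.* range β) x y
      Far-local = _∘ Dist-grow {Q = P (K c k A')} {P (H A)} (2 ℕ.* range β) λ _ _ _ → SubP.∈⊤

      -- A walk of length 2r from a vertex of M_2r(I) cannot leave I, so it would be present in G_I
      -- too. This is the purpose of the predicate C.
      Far-global : ∀ {x y} → C c k x →
        Far (K c k A') (2 ℕ.* range β) x y → Far (H A) (2 ℕ.* range β) x y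
      Far-global x∈C = _∘ Dist-grow {Q = P (H A)} {P (K c k A')} (2 ℕ.* range β) λ z near _ →
        let p , q = Near-2r near in from (dom⇔InI c k z) (InC-near x∈C p q)

      module _ {x} (x∈M : M c k x) where

        near-∈dom : ∀ y → Near (range β) x y → y ∈ˢ dom (I c k)
        near-∈dom y near = let p , q = Near-≤ range≤r near in
          from (dom⇔InI c k y) (InM-near x∈M p q)

        -- From M_r(I) a walk of length r stays inside I, so the ball of the core's radius is the
        -- same in G and in G_I. This is the purpose of the predicate M.
        Ball-local : ∀ y → Ball (H A) (range β) x y ⇔ Ball Hᵢ (range β) x y
        Ball-local y = mk⇔
          (λ (_ , xy) → near-∈dom y (Dist⇒Near Sub.⊤ (P (H A)) (range β) xy) ,
             Dist-grow {Q = P (H A)} {P Hᵢ} (range β) (λ z near _ → near-∈dom z near) xy)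
          (λ (_ , xy) → SubP.∈⊤ ,
             Dist-grow {Q = P Hᵢ} {P (H A)} (range β) (λ _ _ _ → SubP.∈⊤) xy)

        preds-local : ∀ s y → y ∈ˢ dom (I c k) → y ∈ˢ preds G s ⇔ y ∈ˢ P Hᵢ (suc s)
        preds-local s y y∈dom = mk⇔
          (λ y∈ → SubP.x∈p∩q⁺ (y∈ , proj₂ (SubP.x∈p∩q⁻ Sub.⊤ _ y∈dom)))
          (λ y∈ → proj₁ (SubP.x∈p∩q⁻ (preds G s) _ y∈))

        -- On the ball the two interpretations differ in X alone, and by positivity passing to the
        -- larger set keeps the core true.
        Holds-global : A' ⊆ A → Holds Hᵢ ψ x → Holds (H A) ψ x
        Holds-global A'⊆A = Holds-transfer (λ y → Eqv.sym (Ball-local y)) (λ y _ → A'⊆A)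
          (λ s y (y∈ , _) → Eqv.sym (preds-local s y y∈)) ψ occ-ψ
          (from (dom⇔InI c k x) (InM⇒InI x∈M))

        -- Read contrapositively: a vertex of M_r(I) that violates the core in G_I violates it in G.
        Holds-local : (∀ {y} → y ∈ˢ dom (I c k) → y ∈ˢ A → y ∈ˢ A') →
          Holds (H A) ψ x → Holds Hᵢ ψ x
        Holds-local A⊆A' = Holds-transfer Ball-local
          (λ y ball → A⊆A' (proj₁ (to (Ball-local y) ball)))
          (λ s y ball → preds-local s y (proj₁ (to (Ball-local y) ball))) ψ occ-ψ SubP.∈⊤

    -- `ChoiceSpec` admits `nothing` only when the full domain of G_I fails, so a solution in an
    -- interval has to be enlarged to that domain.
    variant-mono : ∀ c k {A A'} {q} → q ℕ.≤ spread β → A ⊆ A' →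
      K c k A ⊨ variant β q → K c k A' ⊨ variant β q
    variant-mono c k {A} {A'} q≤ A⊆A' sat = from (Sat-variant⁺ c k A' q≤)
      (Meaning-map (kind β) far far' (λ x∈C → mono (InC⇒InM x∈C)) mono (to (Sat-variant⁺ c k A q≤) sat))
      where
      far : ∀ {x y} → Far (K c k A) (2 ℕ.* range β) x y → Far (K c k A') (2 ℕ.* range β) x y
      far = _∘ Dist-grow {Q = P (K c k A')} {P (K c k A)} (2 ℕ.* range β) λ _ _ → id
      far' : ∀ {x y} → Far (K c k A') (2 ℕ.* range β) x y → Far (K c k A) (2 ℕ.* range β) x y
      far' = _∘ Dist-grow {Q = P (K c k A)} {P (K c k A')} (2 ℕ.* range β) λ _ _ → id
      ball : ∀ {A A'} {x} y → Ball (reduct embedXL (K c k A)) (range β) x y →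
        Ball (reduct embedXL (K c k A')) (range β) x y
      ball {A} {A'} y (y∈ , xy) = y∈ ,
        Dist-grow {Q = P (reduct embedXL (K c k A))} {P (reduct embedXL (K c k A'))} (range β) (λ _ _ → id) xy
      mono : ∀ {x} → M c k x →
        Holds (reduct embedXL (K c k A)) ψ x → Holds (reduct embedXL (K c k A')) ψ x
      mono {x} x∈M = Holds-transfer (λ y → mk⇔ (ball y) (ball y)) (λ y _ → A⊆A')
        (λ s y _ → Eqv.refl) ψ occ-ψ (from (dom⇔InI c k x) (InM⇒InI x∈M))

    Far-across : ∀ {c k k'} {A} {x y} → k ≢ k' → C c k x → C c k' y → Far (H A) (2 ℕ.* range β) x y
    Far-across {c} {k} {k'} {A} {x} {y} k≢k' x∈ y∈ xy
      with Near-2r (Dist⇒Near Sub.⊤ (P (H A)) (2 ℕ.* range β) xy) | ℤP.<-cmp k k'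
    ... | p , q | tri< k<k' _ _ = i+1≰i (ℤP.≤-trans (across {c} k<k' x∈ y∈) p)
    ... | p , q | tri≈ _ k≡k' _ = k≢k' k≡k'
    ... | p , q | tri> _ _ k'<k = i+1≰i (ℤP.≤-trans (across {c} k'<k y∈ x∈) q)

    M-index : ∀ c x → M c (index c (layer x)) x
    M-index c x = InM-index c (layer x)

    glue : ∀ c {p : ℤ → ℕ} {A : Subset (N G)} (Aₖ : ℤ → Subset (N G)) → (∀ k → Aₖ k ⊆ A) →
      IsPlan (spread β) p → (∀ k → K c k (Aₖ k) ⊨ variant β (p k)) → H A ⊨ basicSentence β
    glue c {p} {A} Aₖ Aₖ⊆A plan sat = from (Sat-basicSentence⁺ A)
      (Meaning-glue {Rᵢ = λ k → Far (K c k (Aₖ k)) (2 ℕ.* range β)} {C c} {M c}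
        (λ {k} x∈ _ → Far-global {c} {k} x∈) (Far-across {c}) (λ {k} → Far-local {c} {k})
        (kind β) {ψᵢ = λ k → Holds (reduct embedXL (K c k (Aₖ k))) ψ}
        (λ x → index c (layer x)) (λ _ → SubP.∈⊤) (λ {x} _ → M-index c x)
        (λ {k} x∈ → Holds-global {c} {k} (InC⇒InM x∈) (Aₖ⊆A k))
        (λ {k} x∈ → Holds-global {c} {k} x∈ (Aₖ⊆A k))
        plan (λ k → to (Sat-variant⁺ c k (Aₖ k) (plan-≤ plan k)) (sat k)))

    module _ (A : Subset (N G)) where

      restrict : ℤ → ℤ → Subset (N G)
      restrict c k = A ∩ dom (I c k)

      -- b is the bound of the window over which a_Rp sums the interval indices.
      LocalPlan : ℕ → ℕ → Set
      LocalPlan o b = Σ (ℤ → ℕ) λ p →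
        ((∀ k → b ℕ.< ℤ.∣ k ∣ → p k ≡ 0) × sumZ b p ≡ spread β) ×
        ∀ k → K (+ o) k (restrict (+ o) k) ⊨ variant β (p k)

      private
        R' : V → V → Set
        R' = Far (H A) (2 ℕ.* range β)

        hold : ∀ c k → V → Set
        hold c k = Holds (reduct embedXL (K c k (restrict c k))) ψ

        restrict-local : ∀ c k {y} → y ∈ˢ dom (I c k) → y ∈ˢ A → y ∈ˢ restrict c k
        restrict-local c k y∈ y∈A = SubP.x∈p∩q⁺ (y∈A , y∈)

      -- `LocalPlan` after translation by `Sat-variant⁺`, with the kind a parameter so that
      -- `local-meaning` can match on it.
      LocalMeaning : Kind → ℕ → ℕ → Set
      LocalMeaning κ o b = Σ (ℤ → ℕ) λ p →
        ((∀ k → b ℕ.< ℤ.∣ k ∣ → p k ≡ 0) × sumZ b p ≡ spread β) ×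
        ∀ k → Meaning κ (p k) (Far (K (+ o) k (restrict (+ o) k)) (2 ℕ.* range β))
          (C (+ o) k) (M (+ o) k) (hold (+ o) k)

      Good : ℕ → ℕ → List V → Set
      Good o b anchors = o ℕ.< d × All (λ x → o ∉ badOffsets (layer x)) anchors ×
        (∀ k x → M (+ o) k x → ℤ.∣ k ∣ ℕ.≤ b)

      -- The anchors are produced before any offset is given, because the offset is chosen later
      -- against the anchors of all terms together.
      local-meaning : ∀ κ →
        Meaning κ (spread β) R' (_∈ˢ Sub.⊤) (_∈ˢ Sub.⊤) (Holds (H A) ψ) →
        Σ (List V) λ anchors → length anchors ℕ.≤ spread β ×
          ∀ {o b} → Good o b anchors → LocalMeaning κ o b
      local-meaning existential (xs , l , far , q) = xs , ℕP.≤-reflexive l , plan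
        where
        plan : ∀ {o b} → Good o b xs → LocalMeaning existential o b
        plan {o} {b} (o<d , good , M≤b) =
          let p , (supp , total) , s = existential-plan
                {Rᵢ = λ k → Far (K (+ o) k (restrict (+ o) k)) (2 ℕ.* range β)} {C (+ o)} {M (+ o)}
                (λ {k} x∈ _ → Far-global {+ o} {k} x∈) (Far-across {+ o}) (λ {k} → Far-local {+ o} {k})
                {ψᵢ = hold (+ o)} (λ x → index (+ o) (layer x))
                (λ x → M≤b (index (+ o) (layer x)) x (M-index (+ o) x))
                (λ {k} x∈ → Holds-local {+ o} {k} (InC⇒InM x∈) (restrict-local (+ o) k))
                xs far
                -- Each witness is its own anchor, so both closeness conditions of `InM⇒InC` hold
                -- with z' = z.
                (All.map (λ {x} x∉bad → InM⇒InC {o} {index (+ o) (layer x)} o<d x∉bad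
                   (z≤z+2R x) (z≤z+2R x) (M-index (+ o) x)) good)
                (All.map proj₂ q)
          in p , (supp , trans total l) , s
          where
          z≤z+2R : ∀ x → layer x ≤ layer x + (R + R)
          z≤z+2R x = ℤP.i≤i+j (layer x) (R + R)
      local-meaning universal h = xs , subst (ℕ._≤ spread β) (sym l) j≤m , plan
        where
        Q : V → Set
        Q x = x ∈ˢ Sub.⊤ × ¬ Holds (H A) ψ x
        Q? : ∀ x → Dec (Q x)
        Q? x = (x SubP.∈? Sub.⊤) ×-dec ¬? (Sat? (H A) (toF ψ) _)
        R'? : ∀ x y → Dec (R' x y)
        R'? x y = ¬? (Dist? (H A) (2 ℕ.* range β) x y)
        ¬spread : ¬ Spread R' Q (suc (spread β))
        ¬spread = Meaning-universal⇒¬Spread {C = _∈ˢ Sub.⊤} h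
        maximal = Spread-max R'? Q? (spread β) ¬spread
        j = proj₁ maximal
        j≤m = proj₁ (proj₂ maximal)
        xs = proj₁ (proj₁ (proj₂ (proj₂ maximal)))
        l : length xs ≡ j
        l = proj₁ (proj₂ (proj₁ (proj₂ (proj₂ maximal))))
        far-q = proj₂ (proj₂ (proj₁ (proj₂ (proj₂ maximal))))
        -- A violator far from every anchor could be prepended to `xs`, against the maximality of j.
        anchored : ∀ {x} → Q x → Any (λ y → Dist (H A) (2 ℕ.* range β) x y) xs
        anchored {x} qx with Any.any? (Dist? (H A) (2 ℕ.* range β) x) xs
        ... | yes a = a
        ... | no ¬a = contradiction
                (x ∷ xs , cong suc l , AllP.¬Any⇒All¬ xs ¬a ∷ proj₁ far-q , qx ∷ proj₂ far-q)
                (proj₂ (proj₂ (proj₂ maximal)))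
        plan : ∀ {o b} → Good o b xs → LocalMeaning universal o b
        plan {o} {b} (o<d , good , M≤b) = universal-plan
            {Rᵢ = Rᵢ} {C (+ o)} {M (+ o)}
            (λ {k} x∈ _ → Far-global {+ o} {k} x∈) (Far-across {+ o}) (λ {k} → Far-local {+ o} {k})
            {Cᵍ = _∈ˢ Sub.⊤} {_∈ˢ Sub.⊤} spreads hold? (λ _ → SubP.∈⊤) (λ {k} {x} → M≤b k x)
            (λ {k} → refuted k) h
          where
          Rᵢ : ℤ → V → V → Set
          Rᵢ k = Far (K (+ o) k (restrict (+ o) k)) (2 ℕ.* range β)
          Rᵢ? : ∀ k x y → Dec (Rᵢ k x y)
          Rᵢ? k x y = ¬? (Dist? (K (+ o) k (restrict (+ o) k)) (2 ℕ.* range β) x y)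
          Qᵢ : ℤ → V → Set
          Qᵢ k x = M (+ o) k x × ¬ hold (+ o) k x
          hold? : ∀ k x → Dec (hold (+ o) k x)
          hold? k x = Sat? (reduct embedXL (K (+ o) k (restrict (+ o) k))) (toF ψ) _
          Qᵢ? : ∀ k x → Dec (Qᵢ k x)
          Qᵢ? k x = InM? (+ o + k * D) (layer x) ×-dec ¬? (hold? k x)
          -- A local violator is a global one, so it lies near an anchor, and the goodness of the
          -- offset moves it from M_r(I) into M_2r(I).
          refuted : ∀ k {x} → M (+ o) k x → ¬ hold (+ o) k x → C (+ o) k x × ¬ Holds (H A) ψ x
          refuted k {x} x∈M ¬hold = x∈C , ¬H
            where
            ¬H : ¬ Holds (H A) ψ x
            ¬H = ¬hold ∘ Holds-local {+ o} {k} x∈M (restrict-local (+ o) k)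
            x∈C : C (+ o) k x
            x∈C = let y , y∈ , xy = find (anchored (SubP.∈⊤ , ¬H))
                      p , q = Near-2r (Dist⇒Near Sub.⊤ (P (H A)) (2 ℕ.* range β) xy)
                  in InM⇒InC {o} {k} {layer y} o<d (All.lookup good y∈) p q x∈M
          spreads : ∀ k → Σ ℕ λ j → Spread (Rᵢ k) (Qᵢ k) j × ¬ Spread (Rᵢ k) (Qᵢ k) (suc j)
          spreads k = proj₁ max , proj₂ (proj₂ max)
            where
            -- By `refuted`, a far-apart system of local violators is one in G, so `spread β` bounds
            -- the search in each interval.
            max = Spread-max (Rᵢ? k) (Qᵢ? k) (spread β) (¬spread ∘ Spread-map
              (λ (x∈M , ¬hold) _ → Far-global {+ o} {k} (proj₁ (refuted k x∈M ¬hold)))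
              (λ (x∈M , ¬hold) → SubP.∈⊤ , proj₂ (refuted k x∈M ¬hold)))

      local-plan : H A ⊨ basicSentence β → Σ (List V) λ anchors → length anchors ℕ.≤ spread β ×
        ∀ {o b} → Good o b anchors → LocalPlan o b
      local-plan sat = let anchors , few , plan = local-meaning (kind β) (to (Sat-basicSentence⁺ A) sat)
        in anchors , few , λ {o} {b} good → let p , isPlan , m = plan good in
           p , isPlan , λ k → from (Sat-variant⁺ (+ o) k _ (plan-≤ (b , isPlan) k)) (m k)

open Covers

-- Rational estimates from the lower bound on ℓ.

module Rationals where

  open import Data.Rational using (_+_; _*_; _≤_; _<_; _⊔_)

  toℚᵘ-toℚ : ∀ k → ℚ.toℚᵘ (toℚ k) ℚᵘ.≃ mkℚᵘ (+ k) 0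
  toℚᵘ-toℚ k = ℚP.toℚᵘ-fromℚᵘ (mkℚᵘ (+ k) 0)

  toℚ-+ : ∀ a b → toℚ (a ℕ.+ b) ≡ toℚ a + toℚ b
  toℚ-+ a b = ℚP.toℚᵘ-injective (begin
    ℚ.toℚᵘ (toℚ (a ℕ.+ b))                   ≈⟨ toℚᵘ-toℚ (a ℕ.+ b) ⟩
    mkℚᵘ (+ (a ℕ.+ b)) 0                     ≈⟨ *≡* (e (+ a) (+ b)) ⟩
    mkℚᵘ (+ a) 0 ℚᵘ.+ mkℚᵘ (+ b) 0           ≈⟨ ℚᵘP.+-cong (toℚᵘ-toℚ a) (toℚᵘ-toℚ b) ⟨
    ℚ.toℚᵘ (toℚ a) ℚᵘ.+ ℚ.toℚᵘ (toℚ b)       ≈⟨ ℚP.toℚᵘ-homo-+ (toℚ a) (toℚ b) ⟨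
    ℚ.toℚᵘ (toℚ a + toℚ b)                   ∎)
    where
    open ℚᵘP.≃-Reasoning
    e : ∀ a b → (a ℤ.+ b) ℤ.* + 1 ≡ (a ℤ.* + 1 ℤ.+ b ℤ.* + 1) ℤ.* + 1
    e = ℤSolver.solve-∀

  toℚ-* : ∀ a b → toℚ (a ℕ.* b) ≡ toℚ a * toℚ b
  toℚ-* a b = ℚP.toℚᵘ-injective (begin
    ℚ.toℚᵘ (toℚ (a ℕ.* b))                   ≈⟨ toℚᵘ-toℚ (a ℕ.* b) ⟩
    mkℚᵘ (+ (a ℕ.* b)) 0                     ≈⟨ *≡* (cong (ℤ._* + 1) (ℤP.pos-* a b)) ⟩
    mkℚᵘ (+ a) 0 ℚᵘ.* mkℚᵘ (+ b) 0           ≈⟨ ℚᵘP.*-cong (toℚᵘ-toℚ a) (toℚᵘ-toℚ b) ⟨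
    ℚ.toℚᵘ (toℚ a) ℚᵘ.* ℚ.toℚᵘ (toℚ b)       ≈⟨ ℚP.toℚᵘ-homo-* (toℚ a) (toℚ b) ⟨
    ℚ.toℚᵘ (toℚ a * toℚ b)                   ∎)
    where open ℚᵘP.≃-Reasoning

  toℚ-mono-≤ : ∀ {a b} → a ℕ.≤ b → toℚ a ≤ toℚ b
  toℚ-mono-≤ {a} {b} a≤b = ℚP.toℚᵘ-cancel-≤
    (ℚᵘP.≤-respˡ-≃ (ℚᵘP.≃-sym (toℚᵘ-toℚ a)) (ℚᵘP.≤-respʳ-≃ (ℚᵘP.≃-sym (toℚᵘ-toℚ b))
      (*≤* (ℤP.*-monoʳ-≤-nonNeg (+ 1) (ℤ.+≤+ a≤b)))))

  toℚ-cancel-< : ∀ {a b} → toℚ a < toℚ b → a ℕ.< b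
  toℚ-cancel-< {a} {b} lt = ℕP.≰⇒> λ b≤a → ℚP.<-irrefl refl (ℚP.<-≤-trans lt (toℚ-mono-≤ b≤a))

  toℚ-mono-< : ∀ {a b} → a ℕ.< b → toℚ a < toℚ b
  toℚ-mono-< {a} {b} lt = ℚP.toℚᵘ-cancel-<
    (ℚᵘP.<-respˡ-≃ (ℚᵘP.≃-sym (toℚᵘ-toℚ a)) (ℚᵘP.<-respʳ-≃ (ℚᵘP.≃-sym (toℚᵘ-toℚ b))
      (*<* (ℤP.*-monoʳ-<-pos (+ 1) (ℤ.+<+ lt)))))

  toℚ-nonNeg : ∀ a → NonNegative (toℚ a)
  toℚ-nonNeg a = nonNegative (toℚ-mono-≤ {0} {a} ℕ.z≤n)

  ∑-toℚ-≤ : ∀ {A : Set} (xs : List A) (f g : A → ℕ) q →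
    (∀ x → toℚ (f x) ≤ q * toℚ (g x)) → toℚ (∑ xs f) ≤ q * toℚ (∑ xs g)
  ∑-toℚ-≤ [] f g q h = ℚP.≤-reflexive (sym (ℚP.*-zeroʳ q))
  ∑-toℚ-≤ (x ∷ xs) f g q h = begin
    toℚ (f x ℕ.+ ∑ xs f)                 ≡⟨ toℚ-+ (f x) (∑ xs f) ⟩
    toℚ (f x) + toℚ (∑ xs f)             ≤⟨ ℚP.+-mono-≤ (h x) (∑-toℚ-≤ xs f g q h) ⟩
    q * toℚ (g x) + q * toℚ (∑ xs g)     ≡⟨ ℚP.*-distribˡ-+ q _ _ ⟨
    q * (toℚ (g x) + toℚ (∑ xs g))       ≡⟨ cong (q *_) (toℚ-+ (g x) (∑ xs g)) ⟨
    q * toℚ (g x ℕ.+ ∑ xs g)             ∎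
    where open ℚP.≤-Reasoning

  module _ (r mt ℓ : ℕ) (ε : ℚ) (ε>0 : Positive ε)
           (large : toℚ (2 ℕ.* r) * (1ℚ + (twoOver ε ε>0 ⊔ toℚ mt)) < toℚ ℓ) where

    private
      instance
        2r≥0 : NonNegative (toℚ (2 ℕ.* r))
        2r≥0 = toℚ-nonNeg (2 ℕ.* r)
        pos-ε : Positive ε
        pos-ε = ε>0
        ε≥0 : NonNegative ε
        ε≥0 = ℚP.pos⇒nonNeg ε
        ε≢0 : ℚ.NonZero ε
        ε≢0 = ℚP.pos⇒nonZero ε

      large-for : ∀ {y} → y ≤ twoOver ε ε>0 ⊔ toℚ mt → toℚ (2 ℕ.* r) * (1ℚ + y) < toℚ ℓ
      large-for y≤ = ℚP.≤-<-trans
        (ℚP.*-monoˡ-≤-nonNeg (toℚ (2 ℕ.* r)) (ℚP.+-monoʳ-≤ 1ℚ y≤)) large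

    large-ℕ : 2 ℕ.* r ℕ.* (1 ℕ.+ mt) ℕ.< ℓ
    large-ℕ = toℚ-cancel-< (subst (_< toℚ ℓ)
      (sym (trans (toℚ-* (2 ℕ.* r) (1 ℕ.+ mt)) (cong (toℚ (2 ℕ.* r) *_) (toℚ-+ 1 mt))))
      (large-for (ℚP.p≤q⊔p (twoOver ε ε>0) (toℚ mt))))

    -- Cancelling 2r from 2r(1 + 2/ε) < 2r + d leaves 2r · 2/ε < d; multiplication by ε gives the
    -- claim.
    4r≤ε*d : ∀ {d} → 2 ℕ.* r ℕ.+ d ≡ ℓ → toℚ (4 ℕ.* r) ≤ ε * toℚ d
    4r≤ε*d {d} refl = begin
      toℚ (4 ℕ.* r)                                 ≡⟨ cong toℚ (e₁ r) ⟩
      toℚ (2 ℕ.* r ℕ.* 2)                           ≡⟨ toℚ-* (2 ℕ.* r) 2 ⟩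
      toℚ (2 ℕ.* r) * toℚ 2                         ≡⟨ cong (toℚ (2 ℕ.* r) *_) (ℚP.*-identityʳ (toℚ 2)) ⟨
      toℚ (2 ℕ.* r) * (toℚ 2 * 1ℚ)                  ≡⟨ cong (λ i → toℚ (2 ℕ.* r) * (toℚ 2 * i)) (ℚP.*-inverseˡ ε) ⟨
      toℚ (2 ℕ.* r) * (toℚ 2 * (1/ ε * ε))          ≡⟨ e₂ (toℚ (2 ℕ.* r)) (toℚ 2) (1/ ε) ε ⟩
      ε * (toℚ (2 ℕ.* r) * twoOver ε ε>0)           ≤⟨ ℚP.*-monoˡ-≤-nonNeg ε 2r*2/ε≤d ⟩
      ε * toℚ d                                     ∎
      where
      open ℚP.≤-Reasoning
      e₁ : ∀ r → 4 ℕ.* r ≡ 2 ℕ.* r ℕ.* 2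
      e₁ = ℕSolver.solve-∀
      e₂ : ∀ a b c d → a * (b * (c * d)) ≡ d * (a * (b * c))
      e₂ = solve 4 (λ a b c d → a :* (b :* (c :* d)) := d :* (a :* (b :* c))) refl
      e₃ : ∀ a y → a * (1ℚ + y) ≡ a + a * y
      e₃ = solve 2 (λ a y → a :* (con 1ℚ :+ y) := a :+ a :* y) refl
      2r*2/ε≤d : toℚ (2 ℕ.* r) * twoOver ε ε>0 ≤ toℚ d
      2r*2/ε≤d = ℚP.<⇒≤ (+-cancelˡ-< (toℚ (2 ℕ.* r)) (subst₂ _<_ (e₃ (toℚ (2 ℕ.* r)) (twoOver ε ε>0))
        (toℚ-+ (2 ℕ.* r) d) (large-for (ℚP.p≤p⊔q (twoOver ε ε>0) (toℚ mt)))))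
        where
        +-cancelˡ-< : ∀ a {b c} → a + b < a + c → b < c
        +-cancelˡ-< a {b} {c} lt = subst₂ _<_ (e a b) (e a c) (ℚP.+-monoʳ-< (ℚ.- a) lt)
          where
          e : ∀ a b → ℚ.- a + (a + b) ≡ b
          e = solve 2 (λ a b → :- a :+ (a :+ b) := b) refl

    cost-bound : ∀ {d} → 2 ℕ.* r ℕ.+ d ≡ ℓ → .{{ℕ.NonZero d}} → ∀ cost size →
      d ℕ.* (cost ℕ.∸ size) ℕ.≤ 4 ℕ.* r ℕ.* size → toℚ cost ≤ (1ℚ + ε) * toℚ size
    cost-bound {d} ℓ≡ cost size le = begin
      toℚ cost                                  ≤⟨ toℚ-mono-≤ (ℕP.m≤n+m∸n cost size) ⟩
      toℚ (size ℕ.+ (cost ℕ.∸ size))            ≡⟨ toℚ-+ size _ ⟩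
      toℚ size + toℚ (cost ℕ.∸ size)            ≤⟨ ℚP.+-monoʳ-≤ (toℚ size) excess≤ ⟩
      toℚ size + ε * toℚ size                   ≡⟨ e₁ (toℚ size) ε ⟩
      (1ℚ + ε) * toℚ size                       ∎
      where
      open ℚP.≤-Reasoning
      e₁ : ∀ s ε → s + ε * s ≡ (1ℚ + ε) * s
      e₁ = solve 2 (λ s ε → s :+ ε :* s := (con 1ℚ :+ ε) :* s) refl
      e₂ : ∀ ε d s → ε * d * s ≡ d * (ε * s)
      e₂ = solve 3 (λ ε d s → ε :* d :* s := d :* (ε :* s)) refl
      excess≤ : toℚ (cost ℕ.∸ size) ≤ ε * toℚ size
      excess≤ = ℚP.*-cancelˡ-≤-pos (toℚ d) {{positive (toℚ-mono-< (ℕP.n≢0⇒n>0 (ℕ.≢-nonZero⁻¹ d)))}} (begin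
        toℚ d * toℚ (cost ℕ.∸ size)             ≡⟨ toℚ-* d _ ⟨
        toℚ (d ℕ.* (cost ℕ.∸ size))             ≤⟨ toℚ-mono-≤ le ⟩
        toℚ (4 ℕ.* r ℕ.* size)                  ≡⟨ toℚ-* (4 ℕ.* r) size ⟩
        toℚ (4 ℕ.* r) * toℚ size                ≤⟨ ℚP.*-monoʳ-≤-nonNeg (toℚ size) {{toℚ-nonNeg size}} (4r≤ε*d ℓ≡) ⟩
        ε * toℚ d * toℚ size                    ≡⟨ e₂ ε (toℚ d) (toℚ size) ⟩
        toℚ d * (ε * toℚ size)                  ∎)

    two-factor-bound : ∀ {d} (ε₁ : ℚ) → Positive ε₁ → 2 ℕ.* r ℕ.+ d ≡ ℓ → .{{ℕ.NonZero d}} →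
      ∀ {b a} cost size → b ℕ.≤ a → toℚ a ≤ (1ℚ + ε₁) * toℚ cost →
      d ℕ.* (cost ℕ.∸ size) ℕ.≤ 4 ℕ.* r ℕ.* size →
      toℚ b ≤ (1ℚ + ε₁) * (1ℚ + ε) * toℚ size
    two-factor-bound ε₁ ε₁>0 ℓ≡ {b} {a} cost size b≤a a≤ le = begin
      toℚ b                                ≤⟨ toℚ-mono-≤ {b} {a} b≤a ⟩
      toℚ a                                ≤⟨ a≤ ⟩
      (1ℚ + ε₁) * toℚ cost                 ≤⟨ ℚP.*-monoˡ-≤-nonNeg (1ℚ + ε₁) (cost-bound ℓ≡ cost size le) ⟩
      (1ℚ + ε₁) * ((1ℚ + ε) * toℚ size)    ≡⟨ ℚP.*-assoc (1ℚ + ε₁) (1ℚ + ε) (toℚ size) ⟨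
      (1ℚ + ε₁) * (1ℚ + ε) * toℚ size      ∎
      where
      open ℚP.≤-Reasoning
      instance
        1+ε₁≥0 : NonNegative (1ℚ + ε₁)
        1+ε₁≥0 = ℚP.nonNeg+nonNeg⇒nonNeg 1ℚ ε₁ {{ℚP.pos⇒nonNeg ε₁ {{ε₁>0}}}}

open Rationals

-- From covers and plans to global solutions, and back.

module Candidates where

  ∈-⋃ : ∀ {n} {p : Subset n} {ps x} → p ∈ ps → x ∈ˢ p → x ∈ˢ ⋃ ps
  ∈-⋃ {ps = _ ∷ _} (here refl) x∈ = SubP.x∈p∪q⁺ (inj₁ x∈)
  ∈-⋃ {ps = _ ∷ _} (there p∈) x∈ = SubP.x∈p∪q⁺ (inj₂ (∈-⋃ p∈ x∈))

  ∣p∪q∣≤∣p∣+∣q∣ : ∀ {n} (p q : Subset n) → ∣ p ∪ q ∣ ℕ.≤ ∣ p ∣ ℕ.+ ∣ q ∣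
  ∣p∪q∣≤∣p∣+∣q∣ Vec.[] Vec.[] = z≤n
  ∣p∪q∣≤∣p∣+∣q∣ (true Vec.∷ p) (true Vec.∷ q) = s≤s (ℕP.≤-trans (∣p∪q∣≤∣p∣+∣q∣ p q)
    (ℕP.+-monoʳ-≤ ∣ p ∣ (ℕP.n≤1+n ∣ q ∣)))
  ∣p∪q∣≤∣p∣+∣q∣ (true Vec.∷ p) (false Vec.∷ q) = s≤s (∣p∪q∣≤∣p∣+∣q∣ p q)
  ∣p∪q∣≤∣p∣+∣q∣ (false Vec.∷ p) (true Vec.∷ q) =
    subst (suc ∣ p ∪ q ∣ ℕ.≤_) (sym (ℕP.+-suc ∣ p ∣ ∣ q ∣)) (s≤s (∣p∪q∣≤∣p∣+∣q∣ p q))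
  ∣p∪q∣≤∣p∣+∣q∣ (false Vec.∷ p) (false Vec.∷ q) = ∣p∪q∣≤∣p∣+∣q∣ p q

  ∣⋃∣≤∑ : ∀ {A : Set} {n} (f : A → Subset n) xs → ∣ ⋃ (map f xs) ∣ ℕ.≤ ∑ xs (λ x → ∣ f x ∣)
  ∣⋃∣≤∑ {n = n} f [] = ℕP.≤-reflexive (SubP.∣⊥∣≡0 n)
  ∣⋃∣≤∑ f (x ∷ xs) = ℕP.≤-trans (∣p∪q∣≤∣p∣+∣q∣ (f x) (⋃ (map f xs)))
    (ℕP.+-monoʳ-≤ ∣ f x ∣ (∣⋃∣≤∑ f xs))

  module _ {u} (φ : BasicConj u) (pos : XPositive (sentence φ))
           (G : LGraph u) (layer : Fin (N G) → ℤ) (layering : IsLayering G layer)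
           (d : ℕ) .{{d≢0 : ℕ.NonZero d}} (ε₁ : ℚ) (ε₁>0 : Positive ε₁) where

    private
      r : ℕ
      r = rangeOf φ

    open Cover G layer r d
    open Setup φ G layer ℓ ε₁ hiding (r)
    open Intervals r d using (InI; D; index; InM-index; InM⇒InI; InI⇒∣k∣≤; badOffsets)

    private
      module T (j : Fin (t φ)) = Term G layer layering r d (terms φ j)
        (f≤maxFin (t φ) (λ i → range (terms φ i)) j)
        (Occ-andFin true (t φ) (λ i → basicSentence (terms φ i)) pos j)

      -- `bound` depends on the cover alone; this is its value before any plan exists, needed
      -- because the plans are built inside that window.
      windowBound : ℤ → ℕ
      windowBound c = sum (map (λ x → ℤ.∣ layer x ∣) (allFin (N G))) ℕ.+ ℤ.∣ c ∣ ℕ.+ ℓ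

      index-bound : ∀ {c k x} → InI (c ℤ.+ k ℤ.* D) (layer x) → ℤ.∣ k ∣ ℕ.≤ windowBound c
      index-bound {c} {k} {x} i = ℕP.≤-trans (InI⇒∣k∣≤ {c} {k} i)
        (ℕP.+-monoˡ-≤ ℓ (ℕP.+-monoˡ-≤ ℤ.∣ c ∣ (∑-∈ (λ x → ℤ.∣ layer x ∣) (∈-allFin x))))

    glue-all : ∀ c (p : Fin (t φ) → ℤ → ℕ) {A} (Aₖ : ℤ → Subset (N G)) → (∀ k → Aₖ k ⊆ A) →
      (∀ j → IsPlan (spread (terms φ j)) (p j)) →
      (∀ k → (I c k ,:= Aₖ k) ⊨ variantConj φ (λ j → p j k)) → (asInterp G ,:= A) ⊨ sentence φ
    glue-all c p {A} Aₖ Aₖ⊆A plans sat =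
      from (⊨-andFin (asInterp G ,:= A) (t φ) (λ i → basicSentence (terms φ i))) λ j →
        T.glue j c Aₖ Aₖ⊆A (plans j) λ k →
          to (⊨-andFin (I c k ,:= Aₖ k) (t φ) (λ i → variant (terms φ i) (p i k))) (sat k) j

    variantConj-mono : ∀ c k (q : Tuple) {A A'} → (∀ j → q j ℕ.≤ spread (terms φ j)) → A ⊆ A' →
      (I c k ,:= A) ⊨ variantConj φ q → (I c k ,:= A') ⊨ variantConj φ q
    variantConj-mono c k q {A} {A'} q≤ A⊆A' sat =
      from (⊨-andFin (I c k ,:= A') (t φ) (λ i → variant (terms φ i) (q i))) λ j →
        T.variant-mono j c k (q≤ j) A⊆A'
          (to (⊨-andFin (I c k ,:= A) (t φ) (λ i → variant (terms φ i) (q i))) sat j)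

    module _ (ch : Chooser) (valid : ValidChooser ch) where

      private
        part : CovPlan → ℤ → Subset (N G)
        part cp k = fromMaybe Sub.⊥ (A_I ch cp k)

        chosen : ∀ i q m → ChoiceSpec i q m → Is-just m →
          ChoiceSpec i q (just (fromMaybe Sub.⊥ m))
        chosen i q (just A) spec _ = spec

        part-spec : ∀ {c p} → Candidate ch (c , p) → ∀ k →
          ChoiceSpec (start ℓ r c k) (λ j → p j k) (just (part (c , p) k))
        part-spec {c} {p} (plans , defined) k = chosen _ _ (A_I ch (c , p) k)
          (valid (start ℓ r c k) (λ j → p j k) (λ j → plan-≤ (plans j) k)) (defined k)

      A_Rp-sat : ∀ cp → Candidate ch cp → (asInterp G ,:= A_Rp ch cp) ⊨ sentence φ
      A_Rp-sat (c , p) cand@(plans , _) =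
        glue-all c p {A_Rp ch (c , p)} (part (c , p)) part⊆ plans λ k → proj₁ (proj₂ (part-spec {c} {p} cand k))
        where
        -- `A_Rp` unites only the parts in the window. A vertex of a part lies in the corresponding
        -- interval, and this puts the index of the interval into the window.
        part⊆ : ∀ k → part (c , p) k ⊆ A_Rp ch (c , p)
        part⊆ k {x} x∈ = ∈-⋃ (∈-map⁺ (part (c , p)) (∈-window k
          (index-bound {c} {k} (to (dom⇔InI c k x) (proj₁ (part-spec {c} {p} cand k) x∈))))) x∈

      ∣A_Rp∣≤a_Rp : ∀ cp → ∣ A_Rp ch cp ∣ ℕ.≤ a_Rp ch cp
      ∣A_Rp∣≤a_Rp cp = ∣⋃∣≤∑ (part cp) (window (bound ch cp))

      module _ (A : Subset (N G)) (c : ℤ) (p : Fin (t φ) → ℤ → ℕ)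
               (plans : ∀ j → IsPlan (spread (terms φ j)) (p j))
               (sat : ∀ k → (I c k ,:= (A ∩ dom (I c k))) ⊨ variantConj φ (λ j → p j k)) where

        private
          is-just : ∀ k m → ChoiceSpec (start ℓ r c k) (λ j → p j k) m → Is-just m
          is-just k (just _) _ = just tt
          -- `nothing` asserts that the full domain fails, whereas the restriction of `A` enlarged
          -- to that domain satisfies the variant.
          is-just k nothing ¬sat = contradiction
            (variantConj-mono c k (λ j → p j k) (λ j → plan-≤ (plans j) k) (SubP.p∩q⊆q A _) (sat k)) ¬sat

        candidate-of-plans : Candidate ch (c , p)
        candidate-of-plans = plans , λ k → is-just k (A_I ch (c , p) k)
          (valid (start ℓ r c k) (λ j → p j k) (λ j → plan-≤ (plans j) k))

        -- In every interval the restriction of `A` is a solution, so γ is at most its size and the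
        -- chosen set at most 1 + ε₁ times that size; these bounds are summed over the window.
        a_Rp-bound : toℚ (a_Rp ch (c , p)) ℚ.≤
          (1ℚ ℚ.+ ε₁) ℚ.* toℚ (sumZ (windowBound c) (λ k → ∣ A ∩ dom (I c k) ∣))
        a_Rp-bound = ∑-toℚ-≤ (window (windowBound c))
          (λ k → ∣ part (c , p) k ∣) (λ k → ∣ A ∩ dom (I c k) ∣) (1ℚ ℚ.+ ε₁) part-size
          where
          instance
            1+ε₁≥0 : ℚ.NonNegative (1ℚ ℚ.+ ε₁)
            1+ε₁≥0 = ℚP.nonNeg+nonNeg⇒nonNeg 1ℚ ε₁ {{ℚP.pos⇒nonNeg ε₁ {{ε₁>0}}}}
          part-size : ∀ k → toℚ ∣ part (c , p) k ∣ ℚ.≤ (1ℚ ℚ.+ ε₁) ℚ.* toℚ ∣ A ∩ dom (I c k) ∣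
          part-size k =
            let g , isγ , g≤ = IsGamma-exists (I c k) (variantConj φ (λ j → p j k))
                  (A ∩ dom (I c k)) (SubP.p∩q⊆q A _) (sat k)
            in ℚP.≤-trans (proj₂ (proj₂ (part-spec {c} {p} candidate-of-plans k)) g isγ)
                 (ℚP.*-monoˡ-≤-nonNeg (1ℚ ℚ.+ ε₁) (toℚ-mono-≤ g≤))

      module _ (A : Subset (N G)) (sat : (asInterp G ,:= A) ⊨ sentence φ) where

        private
          plans : ∀ j → _
          plans j = T.local-plan j A
            (to (⊨-andFin _ (t φ) (λ i → basicSentence (terms φ i))) sat j)

          anchorsOf : Fin (t φ) → List ℤ
          anchorsOf j = map layer (proj₁ (plans j))

          anchors : List ℤ
          anchors = concat (map anchorsOf (allFin (t φ)))

          length-anchors : length anchors ℕ.≤ t φ ℕ.* spreadOf φ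
          length-anchors = begin
            length anchors
              ≡⟨ length-concat-map anchorsOf (allFin (t φ)) ⟩
            ∑ (allFin (t φ)) (λ j → length (anchorsOf j))
              ≤⟨ ∑-mono (allFin (t φ)) (λ {j} _ → ℕP.≤-trans
                (ℕP.≤-reflexive (ListP.length-map layer (proj₁ (plans j))))
                (ℕP.≤-trans (proj₁ (proj₂ (plans j)))
                  (f≤maxFin (t φ) (λ i → spread (terms φ i)) j))) ⟩
            ∑ (allFin (t φ)) (λ _ → spreadOf φ)
              ≡⟨ ∑-const (allFin (t φ)) (spreadOf φ) ⟩
            length (allFin (t φ)) ℕ.* spreadOf φ
              ≡⟨ cong (ℕ._* spreadOf φ) (ListP.length-tabulate {n = t φ} _) ⟩
            t φ ℕ.* spreadOf φ ∎
            where open ℕP.≤-Reasoning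

          W : ℕ → List ℤ
          W o = window (windowBound (+ o))

          S : ℕ → ℤ → Subset (N G)
          S o k = dom (I (+ o) k)

          W-unique : ∀ o → Unique (W o)
          W-unique o = window-unique (windowBound (+ o))

          index∈W : ∀ o x → index (+ o) (layer x) ∈ W o
          index∈W o x = ∈-window _
            (index-bound {+ o} {index (+ o) (layer x)} {x} (InM⇒InI (InM-index (+ o) (layer x))))

          ∈S : ∀ o k x → x ∈ˢ S o k ⇔ InI (+ o ℤ.+ k ℤ.* D) (layer x)
          ∈S o k x = dom⇔InI (+ o) k x

          costOf : ℕ → ℕ
          costOf = cost r d layer A W W-unique index∈W S ∈S

        -- The anchors of all terms are pooled, at most tm of them, so that a single offset is good
        -- for every term and cheap at once. The hypothesis 12rmt < d is the half-bound required by
        -- `good-offset`.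
        good-candidate : 2 ℕ.* r ℕ.* (6 ℕ.* spreadOf φ ℕ.* t φ) ℕ.< d →
          Σ CovPlan λ cp → Candidate ch cp × Σ ℕ λ cost →
            toℚ (a_Rp ch cp) ℚ.≤ (1ℚ ℚ.+ ε₁) ℚ.* toℚ cost ×
            d ℕ.* (cost ℕ.∸ ∣ A ∣) ℕ.≤ 4 ℕ.* r ℕ.* ∣ A ∣
        good-candidate large =
            let o , o<d , notBad , excess≤ = good-offset r d layer A W W-unique index∈W S ∈S anchors few
            in result o o<d notBad excess≤
          where
          few : 2 ℕ.* (length anchors ℕ.* (6 ℕ.* r)) ℕ.< d
          few = ℕP.≤-<-trans (ℕP.*-monoʳ-≤ 2 (ℕP.*-monoˡ-≤ (6 ℕ.* r) length-anchors))
            (subst (ℕ._< d) (e r (spreadOf φ) (t φ)) large)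
            where
            e : ∀ r m t → 2 ℕ.* r ℕ.* (6 ℕ.* m ℕ.* t) ≡ 2 ℕ.* (t ℕ.* m ℕ.* (6 ℕ.* r))
            e = ℕSolver.solve-∀
          result : ∀ o → o ℕ.< d → (∀ z → z ∈ anchors → o ∉ badOffsets z) →
            d ℕ.* (costOf o ℕ.∸ ∣ A ∣) ℕ.≤ 4 ℕ.* r ℕ.* ∣ A ∣ → _
          result o o<d notBad excess≤ =
            (+ o , p) , candidate-of-plans A (+ o) p isPlan sat-on , costOf o ,
            a_Rp-bound A (+ o) p isPlan sat-on , excess≤
            where
            local : ∀ j → T.LocalPlan j A o (windowBound (+ o))
            local j = proj₂ (proj₂ (plans j)) (o<d ,
              All.tabulate (λ {x} x∈ → notBad (layer x) (∈-concat⁺′ (∈-map⁺ layer x∈)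
                (∈-map⁺ anchorsOf (∈-allFin j)))) ,
              λ k x i → index-bound {+ o} {k} {x} (InM⇒InI i))
            p : Fin (t φ) → ℤ → ℕ
            p j = proj₁ (local j)
            isPlan : ∀ j → IsPlan (spread (terms φ j)) (p j)
            isPlan j = windowBound (+ o) , proj₁ (proj₂ (local j))
            sat-on : ∀ k → (I (+ o) k ,:= (A ∩ dom (I (+ o) k))) ⊨ variantConj φ (λ j → p j k)
            sat-on k = from (⊨-andFin (I (+ o) k ,:= (A ∩ dom (I (+ o) k))) (t φ)
              (λ i → variant (terms φ i) (p i k))) λ j → proj₂ (proj₂ (local j)) k

open Candidates

open import Data.Nat using (_*_)
open import Data.Rational using (_+_; _≤_; _<_; _⊔_)
import Data.Fin.Subset
import Data.Rational

-- Assembly of the theorem, with ℓ written as 2r + d.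

module _ {u} (φ : BasicConj u) (pos : XPositive (sentence φ))
         (ε₁ ε₂ : ℚ) (pos₁ : Positive ε₁) (pos₂ : Positive ε₂)
         (G : LGraph u) (λ' : Fin (N G) → ℤ) (layering : IsLayering G λ') where

  private
    r = rangeOf φ
    mt = 6 ℕ.* spreadOf φ ℕ.* t φ

  Large : ℕ → Set
  Large ℓ = toℚ (2 ℕ.* r) ℚ.* (1ℚ + (twoOver ε₂ pos₂ ⊔ toℚ mt)) < toℚ ℓ

  Approximates : ∀ ℓ → Setup.Chooser φ G λ' ℓ ε₁ → Maybe (Setup.CovPlan φ G λ' ℓ ε₁) → Set
  Approximates ℓ ch sel =
    (¬ ((asInterp G ,:= Data.Fin.Subset.⊤) ⊨ sentence φ) × sel ≡ nothing)
    ⊎ Σ (Setup.CovPlan φ G λ' ℓ ε₁) (λ cp → sel ≡ just cp ×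
      (asInterp G ,:= Setup.A_Rp φ G λ' ℓ ε₁ ch cp) ⊨ sentence φ ×
      ((g : ℕ) → IsGamma (asInterp G) (sentence φ) g →
        toℚ ∣ Setup.A_Rp φ G λ' ℓ ε₁ ch cp ∣ ≤ (1ℚ + ε₁) ℚ.* (1ℚ + ε₂) ℚ.* toℚ g))

  module _ (d : ℕ) (large : Large (2 ℕ.* r ℕ.+ d)) where

    private
      ℓ = 2 ℕ.* r ℕ.+ d

    open Setup φ G λ' ℓ ε₁ hiding (r)

    private
      gap : 2 ℕ.* r ℕ.* mt ℕ.< d
      gap = ℕP.+-cancelˡ-< (2 ℕ.* r) _ _ (subst (ℕ._< ℓ) (ℕP.*-suc (2 ℕ.* r) mt)
        (large-ℕ r mt ℓ ε₂ pos₂ large))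

      -- The strict inequality gives d > 0 also when r = 0, that is ℓ ≥ 2r + 1, as a cover requires.
      instance
        d≢0 : ℕ.NonZero d
        d≢0 = ℕ.>-nonZero (ℕP.≤-<-trans z≤n gap)

    module _ (ch : Chooser) (valid : ValidChooser ch) where

      -- The bound is given for every b below `a_Rp` of the candidate, since the size of the
      -- selected set is reached through minimality of its own `a_Rp`.
      candidate : ∀ A → (asInterp G ,:= A) ⊨ sentence φ → Σ CovPlan λ cp → Candidate ch cp ×
        (∀ {b} → b ℕ.≤ a_Rp ch cp → toℚ b ≤ (1ℚ + ε₁) ℚ.* (1ℚ + ε₂) ℚ.* toℚ ∣ A ∣)
      candidate A sat =
        let cp , cand , cost , a≤ , excess≤ = good-candidate φ pos G λ' layering d ε₁ pos₁ ch valid A sat gap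
        in cp , cand , λ {b} b≤a →
             two-factor-bound r mt ℓ ε₂ pos₂ large {d} ε₁ pos₁ refl {b} {a_Rp ch cp} cost ∣ A ∣ b≤a a≤ excess≤

      approximates : ∀ sel → SelSpec ch sel → Approximates ℓ ch sel
      approximates nothing none = inj₁
        ((λ sat → let cp , cand , _ = candidate Data.Fin.Subset.⊤ sat in none (cp , cand)) , refl)
      approximates (just cp) (cand , minimal) = inj₂ (cp , refl ,
        A_Rp-sat φ pos G λ' layering d ε₁ pos₁ ch valid cp cand , bound-γ)
        where
        bound-γ : ∀ g → IsGamma (asInterp G) (sentence φ) g →
          toℚ ∣ A_Rp ch cp ∣ ≤ (1ℚ + ε₁) ℚ.* (1ℚ + ε₂) ℚ.* toℚ g
        bound-γ g ((A , _ , sat , refl) , _) =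
          let cp' , cand' , a≤ = candidate A sat
          in a≤ {∣ A_Rp ch cp ∣} (ℕP.≤-trans
               (∣A_Rp∣≤a_Rp φ pos G λ' layering d ε₁ pos₁ ch valid cp) (minimal cp' cand'))

  -- With ℓ a variable the equation can be matched on, which carries the result for 2r + d over to ℓ
  -- and everything whose type mentions it.
  approximates-≡ : ∀ {ℓ} d → 2 ℕ.* r ℕ.+ d ≡ ℓ → Large ℓ → ∀ ch → Setup.ValidChooser φ G λ' ℓ ε₁ ch →
    ∀ sel → Setup.SelSpec φ G λ' ℓ ε₁ ch sel → Approximates ℓ ch sel
  approximates-≡ d refl large = approximates d large

theorem18 : ∀ {u} (φ : BasicConj u) → XPositive (sentence φ) →
    (ε₁ ε₂ : ℚ) → Positive ε₁ → (pos₂ : Positive ε₂) →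
    (G : LGraph u) (λ' : Fin (N G) → ℤ) → IsLayering G λ' →
    (ℓ : ℕ) →
    toℚ (2 * rangeOf φ) Data.Rational.* (1ℚ + (twoOver ε₂ pos₂ ⊔ toℚ (6 * spreadOf φ * t φ))) < toℚ ℓ →
    (ch : Setup.Chooser φ G λ' ℓ ε₁) → Setup.ValidChooser φ G λ' ℓ ε₁ ch →
    (sel : Maybe (Setup.CovPlan φ G λ' ℓ ε₁)) → Setup.SelSpec φ G λ' ℓ ε₁ ch sel →
    (¬ ((asInterp G ,:= Data.Fin.Subset.⊤) ⊨ sentence φ) × sel ≡ nothing)
    ⊎ Σ (Setup.CovPlan φ G λ' ℓ ε₁) (λ cp → sel ≡ just cp ×
    (asInterp G ,:= Setup.A_Rp φ G λ' ℓ ε₁ ch cp) ⊨ sentence φ ×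
    ((g : ℕ) → IsGamma (asInterp G) (sentence φ) g →
    toℚ ∣ Setup.A_Rp φ G λ' ℓ ε₁ ch cp ∣
    ≤ (1ℚ + ε₁) Data.Rational.* (1ℚ + ε₂) Data.Rational.* toℚ g))
theorem18 φ pos ε₁ ε₂ pos₁ pos₂ G λ' layering ℓ large =
  let r = rangeOf φ
      mt = 6 ℕ.* spreadOf φ ℕ.* t φ
      -- Here 2r ≤ 2r(1 + 6mt) < ℓ, so the difference ℓ - 2r exists as a natural number.
      d , 2r+d≡ℓ = ℕP.m≤n⇒∃[o]m+o≡n (ℕP.≤-trans (ℕP.m≤m*n (2 ℕ.* r) (suc mt))
        (ℕP.<⇒≤ (large-ℕ r mt ℓ ε₂ pos₂ large)))
  in approximates-≡ φ pos ε₁ ε₂ pos₁ pos₂ G λ' layering d 2r+d≡ℓ large
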